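{- For every positive integer $d$, there exist infinitely many monic rigid Carmichael polynomials of order $d$ in $\mathbb{F}_q[t]$.
   Context: $\mathbb{F}_q$ is the finite field with $q$ elements. For an integer $d\ge1$, a rigid Carmichael polynomial of order $d$ in $\mathbb{F}_q[t]$ is a reducible square-free polynomial $g\in\mathbb{F}_q[t]$ such that $i\cdot\deg P$ divides $d\cdot\deg g$ for every irreducible polynomial $P$ dividing $g$ and every $i=1,\dots,d$. -}

module Defs where

open import Algebra.Bundles using (CommutativeRing)
open import Algebra.Bundles.Raw using (RawSemiring)
open import Data.Bool.Base using (if_then_else_)
import Data.Fin.Properties as Fin
open import Data.Fin.Base using (Fin)
open import Data.List.Base using (List; []; _∷_; map)
open import Data.List.Relation.Unary.All using (all?)
import Data.Nat.Base as ℕ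
open import Data.Nat.Base using (ℕ; zero; suc)
import Data.Nat.Divisibility as ℕ
open import Data.Product.Base using (∃; ∃₂; Σ-syntax; _×_)
open import Function.Bundles using (Bijection)
open import Function.Definitions using (Injective)
open import Level using (Level; _⊔_) renaming (suc to lsuc)
open import Relation.Binary.Definitions using (Decidable)
open import Relation.Binary.PropositionalEquality using (_≡_)
import Relation.Binary.PropositionalEquality.Properties as ≡
open import Relation.Nullary.Decidable using (does; via-injection)

record FiniteField (c ℓ : Level) (q : ℕ) : Set (lsuc (c ⊔ ℓ)) where
  field
    commutativeRing : CommutativeRing c ℓ

  open CommutativeRing commutativeRing public

  field
    1≉0         : 1# ≉ 0#
    inverse     : ∀ x → x ≉ 0# → ∃ λ y → x * y ≈ 1#
    enumeration : Bijection setoid (≡.setoid (Fin q))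

  infix 4 _≈?_

  _≈?_ : Decidable _≈_
  _≈?_ = via-injection (Bijection.injection enumeration) Fin._≟_

module Polynomials {c ℓ : Level} {q : ℕ} (F : FiniteField c ℓ q) where

  private module F = FiniteField F

  -- a₀ ∷ a₁ ∷ … ∷ aₙ ∷ [] stands for a₀ + a₁ t + … + aₙ tⁿ.  Trailing zeros
  -- are allowed, so a polynomial is a list only up to the equality _≈_ below.
  Poly : Set c
  Poly = List F.Carrier

  coeff : Poly → ℕ → F.Carrier
  coeff []      _       = F.0#
  coeff (a ∷ _) zero    = a
  coeff (_ ∷ p) (suc n) = coeff p n

  infix  4 _≈_
  infixl 6 _+_
  infixl 7 _*_

  -- A record, rather than a function type, so that p and q can be inferred.
  record _≈_ (p q : Poly) : Set ℓ where
    constructor mk≈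
    field
      coeff-≈ : ∀ n → coeff p n F.≈ coeff q n

  _+_ : Poly → Poly → Poly
  []      + q       = q
  (a ∷ p) + []      = a ∷ p
  (a ∷ p) + (b ∷ q) = (a F.+ b) ∷ (p + q)

  -- (a + t p) q = a q + t (p q)
  _*_ : Poly → Poly → Poly
  []      * q = []
  (a ∷ p) * q = map (a F.*_) q + (F.0# ∷ p * q)

  rawSemiring : RawSemiring c ℓ
  rawSemiring = record
    { Carrier = Poly
    ; _≈_     = _≈_
    ; _+_     = _+_
    ; _*_     = _*_
    ; 0#      = []
    ; 1#      = F.1# ∷ []
    }

  open RawSemiring rawSemiring public using (0#; 1#; _≉_)
  open import Algebra.Definitions.RawSemiring rawSemiring public
    using (_∣_; _∤_; Irreducible)

  -- The degree ignores trailing zeros; the zero polynomial gets the junk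
  -- value 0.
  deg : Poly → ℕ
  deg []      = 0
  deg (_ ∷ p) = if does (all? (F._≈? F.0#) p) then 0 else suc (deg p)

  Monic : Poly → Set ℓ
  Monic p = coeff p (deg p) F.≈ F.1#

  -- The units are the divisors of 1#.  The zero polynomial is reducible in
  -- this sense, but it is not square-free.
  Reducible : Poly → Set (c ⊔ ℓ)
  Reducible p = ∃₂ λ a b → a ∤ 1# × b ∤ 1# × p ≈ a * b

  SquareFree : Poly → Set (c ⊔ ℓ)
  SquareFree p = ∀ h → h * h ∣ p → h ∣ 1#

  record RigidCarmichael (d : ℕ) (g : Poly) : Set (c ⊔ ℓ) where
    field
      reducible  : Reducible g
      squareFree : SquareFree g
      divides    : ∀ P → Irreducible P → P ∣ g →
                   ∀ i → 1 ℕ.≤ i → i ℕ.≤ d →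
                   i ℕ.* deg P ℕ.∣ d ℕ.* deg g

  -- There are infinitely many polynomials satisfying S, pairwise distinct as
  -- polynomials and not merely as coefficient lists.
  InfinitelyMany : ∀ {s} → (Poly → Set s) → Set (c ⊔ ℓ ⊔ s)
  InfinitelyMany S = Σ[ f ∈ (ℕ → Poly) ] Injective _≡_ _≈_ f × (∀ n → S (f n))

{-# OPTIONS --safe #-}
module Submission where

open import Defs
open import Algebra.Bundles using (CommutativeRing; Semiring)
open import Algebra.Definitions.RawMagma using (_,_)
import Algebra.Definitions.RawSemiring as RawSemiring
import Algebra.Morphism.Construct.Identity as Identity
open import Algebra.Morphism.Structures using (module SemiringMorphisms)
import Algebra.Properties.CommutativeMonoid.Sum as Sum
import Algebra.Properties.CommutativeSemiring.Exp as Exp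
import Algebra.Properties.Ring as RingProperties
import Algebra.Solver.Ring.NaturalCoefficients.Default as NaturalSolver
open import Data.Fin.Base as Fin using (Fin; zero; suc)
open import Data.Fin.Permutation using (Permutation; permutation)
import Data.Fin.Properties as Fin
open import Data.List.Base using ([]; _∷_; map; tabulate)
open import Data.List.Relation.Unary.All using (All; []; _∷_; all?)
open import Data.Nat.Base as ℕ using (ℕ; zero; suc; NonZero; z≤n; s≤s)
open import Data.Nat.DivMod using (_%_; _/_; m≡m%n+[m/n]*n; m%n<n)
import Data.Nat.Divisibility as ℕ
import Data.Nat.Properties as ℕ
open import Data.Product.Base using (_×_; _,_; proj₁; proj₂; ∃; ∃₂)
open import Data.Sum.Base using (_⊎_; inj₁; inj₂)
open import Function.Base using (_∘_; id)
open import Function.Bundles using (Bijection)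
open import Function.Definitions using (Injective)
open import Level using (Level; _⊔_)
open import Relation.Binary.Definitions using (tri<; tri≈; tri>)
import Relation.Binary.PropositionalEquality as ≡
open ≡ using (_≡_; _≢_)
import Relation.Binary.Reasoning.Setoid as SetoidReasoning
open import Relation.Nullary using (¬_; yes; no; contradiction)

-- Let T n = t^(q^n) − t.  For m ∣ n the polynomial T m divides T n, and for m = q^b, n = q^(b+v) the
-- quotients g = T n / T m are rigid Carmichael for a suitable v and all large b.  By the Frobenius
-- identity f(t)^(q^n) = f(t^(q^n)) every polynomial equals its q^n-th power modulo any divisor of
-- T n.  Applied modulo h² this makes T n square-free; applied in the residue field F[t]/(P), which
-- has q^(deg P) elements, it makes deg P a divisor of n for every irreducible P ∣ T n.  So it
-- suffices that d! n divides deg g = q^n − q^m, which holds because the powers of q are eventually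
-- periodic modulo every number.
--
-- The Frobenius identity needs no characteristic: (1 + X)^q − 1 − X^q has degree less than q and,
-- as a^q = a for all a, vanishes on the whole field.

-- The degree of `T n` itself is a power of q and has only the prime factors of q, so it cannot
-- absorb d!; dividing by `T m` turns the degree into a difference of such powers. The choice of m
-- and n as powers of q serves two purposes. First, q^n - q^m is divisible by a high power of q,
-- which contains the factor n = q^(b+v) as soon as b is large. Second, d! divides q^n - q^m if m is
-- past the preperiod u of q modulo d! and n - m is a multiple of the period v₀; since n - m =
-- q^(b+v) - q^b is again a difference of powers of q, this is the same periodicity problem modulo
-- v₀, and its solution is v. Asking for v ≥ 2 leaves q^(b+1) strictly between m and n, which splits
-- the quotient into two non-constant factors.

-- Arithmetic of the powers of q: eventual periodicity and divisibility of the degree.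

module Powers (q : ℕ) (2≤q : 2 ℕ.≤ q) where
  open import Data.Nat.Base
  open import Data.Nat.Properties
  open import Data.Nat.Divisibility
  open import Data.Nat.DivMod using (_mod_; _%_; _/_; m≡m%n+[m/n]*n; m%n<n; /-monoˡ-≤)
  open import Data.Nat.Solver using (module +-*-Solver)
  open ≡
  open +-*-Solver using (solve; _:=_; _:+_; _:*_)
  open ≡-Reasoning

  1≤q^ : ∀ n → 1 ≤ q ^ n
  1≤q^ n = m^n>0 q {{>-nonZero (<⇒≤ 2≤q)}} n

  n<q^n : ∀ n → n < q ^ n
  n<q^n zero    = s≤s z≤n
  n<q^n (suc n) = ≤-trans (s≤s (n<q^n n)) (≤-trans
    (+-monoˡ-≤ (q ^ n) (1≤q^ n))
    (≤-trans (≤-reflexive (cong (q ^ n +_) (sym (+-identityʳ _))))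
      (*-monoˡ-≤ (q ^ n) 2≤q)))

  2≤q^ : ∀ {n} → 1 ≤ n → 2 ≤ q ^ n
  2≤q^ {n} 1≤n = ≤-trans (s≤s 1≤n) (n<q^n n)

  -- Serves to fit b + v + u below q^b: for large b the part v + u is at most b.
  n+n≤q^n : ∀ n → n + n ≤ q ^ n
  n+n≤q^n zero    = z≤n
  n+n≤q^n (suc n) = ≤-trans (≤-reflexive (cong (suc n +_) (sym (+-identityʳ (suc n)))))
    (*-mono-≤ 2≤q (n<q^n n))

  %≡⇒difference : ∀ {m n} D .{{_ : NonZero D}} → m ≤ n → m % D ≡ n % D →
                  ∃ λ s → n ≡ m + s * D
  %≡⇒difference {m} {n} D m≤n eq = n / D ∸ m / D , (begin
    n                                             ≡⟨ m≡m%n+[m/n]*n n D ⟩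
    n % D + n / D * D                             ≡⟨ cong₂ (λ r k → r + k * D) (sym eq)
                                                       (sym (m+[n∸m]≡n (/-monoˡ-≤ D m≤n))) ⟩
    m % D + (m / D + (n / D ∸ m / D)) * D         ≡⟨ solve 4 (λ r k l D → r :+ (k :+ l) :* D
                                                       := r :+ k :* D :+ l :* D) refl
                                                       (m % D) (m / D) (n / D ∸ m / D) D ⟩
    m % D + m / D * D + (n / D ∸ m / D) * D       ≡⟨ cong (_+ (n / D ∸ m / D) * D)
                                                       (m≡m%n+[m/n]*n m D) ⟨
    m + (n / D ∸ m / D) * D                       ∎)

  -- The congruence of q^(u+v) and q^u modulo D as an equation in ℕ: with the larger power on the
  -- left, neither subtraction nor a negative multiple occurs.
  record Period (D u v : ℕ) : Set where
    constructor period
    field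
      factor   : ℕ
      equation : q ^ (u + v) ≡ q ^ u + factor * D

  m<n⇒n≡m+suc : ∀ {m n} → m < n → ∃ λ v → n ≡ m + suc v
  m<n⇒n≡m+suc {m} {n} m<n = n ∸ suc m , sym (trans (+-suc m _) (m+[n∸m]≡n m<n))

  -- Even exponents make the period at least 2.
  eventually-periodic : ∀ D .{{_ : NonZero D}} → ∃₂ λ u v → 2 ≤ v × Period D u v
  eventually-periodic D
    with i , j , i<j , eq ← Fin.pigeonhole (n<1+n D) (λ i → (q ^ (2 * Fin.toℕ i)) mod D)
    with v , j≡i+v ← m<n⇒n≡m+suc i<j
    with s , eq′ ← %≡⇒difference D (^-monoʳ-≤ q {{>-nonZero (<⇒≤ 2≤q)}}
                     (*-monoʳ-≤ 2 (<⇒≤ i<j))) (Fin.fromℕ<-injective _ _ _ _ eq)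
    = 2 * Fin.toℕ i , 2 * suc v , *-monoʳ-≤ 2 (s≤s z≤n) ,
      period s (trans (cong (q ^_) (trans (sym (*-distribˡ-+ 2 (Fin.toℕ i) (suc v)))
        (cong (2 *_) (sym j≡i+v)))) eq′)

  period-multiple : ∀ {D u v} k → Period D u v → Period D u (k * v)
  period-multiple {D} {u} zero _ = period 0 (trans (cong (q ^_) (+-identityʳ u)) (sym (+-identityʳ _)))
  period-multiple {D} {u} {v} (suc k) p@(period s eq)
    with period t eq′ ← period-multiple k p = period (s + t * q ^ v) (begin
      q ^ (u + (v + k * v))            ≡⟨ cong (q ^_) (solve 3 (λ u v w → u :+ (v :+ w) := u :+ w :+ v)
                                            refl u v (k * v)) ⟩
      q ^ (u + k * v + v)              ≡⟨ ^-distribˡ-+-* q (u + k * v) v ⟩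
      q ^ (u + k * v) * q ^ v          ≡⟨ cong (_* q ^ v) eq′ ⟩
      (q ^ u + t * D) * q ^ v          ≡⟨ solve 4 (λ a t D b → (a :+ t :* D) :* b
                                            := a :* b :+ t :* b :* D) refl (q ^ u) t D (q ^ v) ⟩
      q ^ u * q ^ v + t * q ^ v * D    ≡⟨ cong (_+ t * q ^ v * D) (^-distribˡ-+-* q u v) ⟨
      q ^ (u + v) + t * q ^ v * D      ≡⟨ cong (_+ t * q ^ v * D) eq ⟩
      q ^ u + s * D + t * q ^ v * D    ≡⟨ solve 4 (λ a s D b → a :+ s :* D :+ b :* D
                                            := a :+ (s :+ b) :* D) refl (q ^ u) s D (t * q ^ v) ⟩
      q ^ u + (s + t * q ^ v) * D      ∎)

  -- The congruence is multiplied by q^x. The factor q^x stays visible because it later supplies the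
  -- divisor q^(b+v).
  period-shift : ∀ {D u v} x → Period D u v → ∃ λ s → q ^ (x + u + v) ≡ q ^ (x + u) + q ^ x * (s * D)
  period-shift {D} {u} {v} x (period s eq) = s , (begin
    q ^ (x + u + v)                ≡⟨ cong (q ^_) (+-assoc x u v) ⟩
    q ^ (x + (u + v))              ≡⟨ ^-distribˡ-+-* q x (u + v) ⟩
    q ^ x * q ^ (u + v)            ≡⟨ cong (q ^ x *_) eq ⟩
    q ^ x * (q ^ u + s * D)        ≡⟨ *-distribˡ-+ (q ^ x) (q ^ u) (s * D) ⟩
    q ^ x * q ^ u + q ^ x * (s * D) ≡⟨ cong (_+ q ^ x * (s * D)) (^-distribˡ-+-* q x u) ⟨
    q ^ (x + u) + q ^ x * (s * D)  ∎)

  -- The outer period of q is taken modulo D, the inner one modulo that period.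
  degree-divisible : ∀ D .{{_ : NonZero D}} → ∃₂ λ b₀ v → 2 ≤ v × (∀ b → b₀ ≤ b →
    ∀ N → N + q ^ (q ^ b) ≡ q ^ (q ^ (b + v)) → D * q ^ (b + v) ∣ N)
  degree-divisible D with u , v₀ , 2≤v₀ , outer ← eventually-periodic D
    with u′ , v , 2≤v , inner ← eventually-periodic v₀ {{>-nonZero (<⇒≤ 2≤v₀)}}
    -- The summand u′ passes the preperiod modulo `v₀`; the rest gives v + u ≤ b, hence b + v + u ≤
    -- b + b ≤ q^b.
    = u′ + (v + u) , v , 2≤v , divisible
    where
    divisible : ∀ b → u′ + (v + u) ≤ b → ∀ N → N + q ^ (q ^ b) ≡ q ^ (q ^ (b + v)) →
                D * q ^ (b + v) ∣ N
    divisible b b₀≤b N N+q^m≡q^n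
      with s , q^[b+v]≡ ← period-shift (b ∸ u′) inner
      -- By the inner periodicity, n - m equals `q ^ (b ∸ u′) * s` periods of length `v₀`.
      with t , q^n≡ ← period-shift (q ^ b ∸ u) (period-multiple (q ^ (b ∸ u′) * s) outer)
      = subst (D * q ^ (b + v) ∣_) (sym N≡) (subst (D * q ^ (b + v) ∣_) (*-comm (t * D) (q ^ (q ^ b ∸ u)))
          (*-pres-∣ (n∣m*n t) (m≤n⇒q^m∣q^n b+v≤q^b∸u)))
      where
      u′≤b : u′ ≤ b
      u′≤b = ≤-trans (m≤m+n u′ (v + u)) b₀≤b
      b+v+u≤q^b : b + v + u ≤ q ^ b
      b+v+u≤q^b = ≤-trans (≤-reflexive (+-assoc b v u)) (≤-trans
        (+-monoʳ-≤ b (≤-trans (m≤n+m (v + u) u′) b₀≤b)) (n+n≤q^n b))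
      b+v≤q^b∸u : b + v ≤ q ^ b ∸ u
      b+v≤q^b∸u = m+n≤o⇒m≤o∸n (b + v) b+v+u≤q^b
      u≤q^b : u ≤ q ^ b
      u≤q^b = ≤-trans (m≤n+m u (b + v)) b+v+u≤q^b
      m≤n⇒q^m∣q^n : ∀ {m n} → m ≤ n → q ^ m ∣ q ^ n
      m≤n⇒q^m∣q^n {m} {n} m≤n = subst (λ k → q ^ m ∣ q ^ k) (m+[n∸m]≡n m≤n)
        (subst (q ^ m ∣_) (sym (^-distribˡ-+-* q m (n ∸ m))) (m∣m*n _))
      n≡ : q ^ b ∸ u + u + q ^ (b ∸ u′) * s * v₀ ≡ q ^ (b + v)
      n≡ = begin
        q ^ b ∸ u + u + q ^ (b ∸ u′) * s * v₀          ≡⟨ cong₂ _+_ (m∸n+n≡m u≤q^b)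
                                                            (*-assoc (q ^ (b ∸ u′)) s v₀) ⟩
        q ^ b + q ^ (b ∸ u′) * (s * v₀)                ≡⟨ cong (λ x → q ^ x + q ^ (b ∸ u′) * (s * v₀))
                                                            (m∸n+n≡m u′≤b) ⟨
        q ^ (b ∸ u′ + u′) + q ^ (b ∸ u′) * (s * v₀)    ≡⟨ q^[b+v]≡ ⟨
        q ^ (b ∸ u′ + u′ + v)                          ≡⟨ cong (λ x → q ^ (x + v)) (m∸n+n≡m u′≤b) ⟩
        q ^ (b + v)                                    ∎
      N≡ : N ≡ q ^ (q ^ b ∸ u) * (t * D)
      N≡ = +-cancelʳ-≡ (q ^ (q ^ b)) N (q ^ (q ^ b ∸ u) * (t * D)) (begin
        N + q ^ (q ^ b)                                 ≡⟨ N+q^m≡q^n ⟩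
        q ^ (q ^ (b + v))                               ≡⟨ cong (q ^_) n≡ ⟨
        q ^ (q ^ b ∸ u + u + q ^ (b ∸ u′) * s * v₀)     ≡⟨ q^n≡ ⟩
        q ^ (q ^ b ∸ u + u) + q ^ (q ^ b ∸ u) * (t * D) ≡⟨ cong (λ x → q ^ x + q ^ (q ^ b ∸ u) * (t * D))
                                                             (m∸n+n≡m u≤q^b) ⟩
        q ^ (q ^ b) + q ^ (q ^ b ∸ u) * (t * D)         ≡⟨ +-comm (q ^ (q ^ b)) _ ⟩
        q ^ (q ^ b ∸ u) * (t * D) + q ^ (q ^ b)         ∎)

  -- With n′ = k + 1 the power q^k separates the two: M < q^n ≤ q^k, whereas N = q^n′ - q^m′ ≥ 2 q^k
  -- - q^k.
  degree-increasing : ∀ {M N m n m′ n′} → M + q ^ m ≡ q ^ n → N + q ^ m′ ≡ q ^ n′ →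
                      n < n′ → m′ < n′ → M < N
  degree-increasing {M} {N} {m} {n} {m′} {suc k} M≡ N≡ (s≤s n≤k) (s≤s m′≤k) = <-≤-trans
    (≤-trans (m<m+n M (1≤q^ m)) (≤-trans (≤-reflexive M≡) (^-monoʳ-≤ q n≤k)))
    (+-cancelʳ-≤ (q ^ m′) (q ^ k) N (≤-trans (+-monoʳ-≤ (q ^ k) (^-monoʳ-≤ q m′≤k))
      (≤-trans (≤-reflexive (cong (q ^ k +_) (sym (+-identityʳ _))))
        (≤-trans (*-monoˡ-≤ (q ^ k) 2≤q) (≤-reflexive (sym N≡))))))
    where instance _ = >-nonZero (<⇒≤ 2≤q)

-- The quotient of a commutative ring by a principal ideal.

module Quotient {c ℓ} (R : CommutativeRing c ℓ) (w : CommutativeRing.Carrier R) where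
  open CommutativeRing R
  open NaturalSolver commutativeSemiring using (solve; _:=_; _:+_; _:*_)
  open RingProperties ring using (-‿distribˡ-*; -‿+-comm)
  open SetoidReasoning setoid

  infix 4 _≈ʷ_

  -- Additive form of `w ∣ x - y`: compatibility with sums and products becomes an identity of
  -- commutative semirings, within reach of the solver.
  record _≈ʷ_ (x y : Carrier) : Set (c ⊔ ℓ) where
    constructor by
    field
      factor   : Carrier
      equation : x ≈ y + factor * w

  ≈⇒≈ʷ : ∀ {x y} → x ≈ y → x ≈ʷ y
  ≈⇒≈ʷ x≈y = by 0# (trans x≈y (sym (trans (+-congˡ (zeroˡ w)) (+-identityʳ _))))

  symʷ : ∀ {x y} → x ≈ʷ y → y ≈ʷ x
  symʷ {x} {y} (by k x≈y+kw) = by (- k) (begin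
    y                       ≈⟨ +-identityʳ y ⟨
    y + 0#                  ≈⟨ +-congˡ (-‿inverseʳ (k * w)) ⟨
    y + (k * w - k * w)     ≈⟨ +-assoc y (k * w) _ ⟨
    (y + k * w) - k * w     ≈⟨ +-cong (sym x≈y+kw) (-‿distribˡ-* k w) ⟩
    x + - k * w             ∎)

  transʷ : ∀ {x y z} → x ≈ʷ y → y ≈ʷ z → x ≈ʷ z
  transʷ (by k x≈) (by l y≈) = by (l + k) (trans x≈ (trans (+-congʳ y≈)
    (solve 4 (λ z l k w → z :+ l :* w :+ k :* w := z :+ (l :+ k) :* w) refl _ l k w)))

  +-congʷ : ∀ {x y u v} → x ≈ʷ y → u ≈ʷ v → x + u ≈ʷ y + v
  +-congʷ (by k x≈) (by l u≈) = by (k + l) (trans (+-cong x≈ u≈)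
    (solve 5 (λ y k w v l → y :+ k :* w :+ (v :+ l :* w) := y :+ v :+ (k :+ l) :* w)
      refl _ k w _ l))

  *-congʷ : ∀ {x y u v} → x ≈ʷ y → u ≈ʷ v → x * u ≈ʷ y * v
  *-congʷ {y = y} {v = v} (by k x≈) (by l u≈) = by (k * v + y * l + k * w * l)
    (trans (*-cong x≈ u≈) (solve 5 (λ y k w v l → (y :+ k :* w) :* (v :+ l :* w)
       := y :* v :+ (k :* v :+ y :* l :+ k :* w :* l) :* w) refl y k w v l))

  -‿congʷ : ∀ {x y} → x ≈ʷ y → - x ≈ʷ - y
  -‿congʷ {y = y} (by k x≈) = by (- k) (trans (-‿cong x≈)
    (trans (sym (-‿+-comm y (k * w))) (+-congˡ (-‿distribˡ-* k w))))

  -- Carrier and operations are kept and only the equality is coarsened, so every element is its own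
  -- residue class.
  quotientRing : CommutativeRing c (c ⊔ ℓ)
  quotientRing = record
    { Carrier = Carrier
    ; _≈_     = _≈ʷ_
    ; _+_     = _+_
    ; _*_     = _*_
    ; -_      = -_
    ; 0#      = 0#
    ; 1#      = 1#
    ; isCommutativeRing = record
      { isRing = record
        { +-isAbelianGroup = record
          { isGroup = record
            { isMonoid = record
              { isSemigroup = record
                { isMagma = record
                  { isEquivalence = record
                    { refl = ≈⇒≈ʷ refl ; sym = symʷ ; trans = transʷ }
                  ; ∙-cong = +-congʷ
                  }
                ; assoc = λ x y z → ≈⇒≈ʷ (+-assoc x y z)
                }
              ; identity = (λ x → ≈⇒≈ʷ (+-identityˡ x)) , (λ x → ≈⇒≈ʷ (+-identityʳ x))
              }
            ; inverse = (λ x → ≈⇒≈ʷ (-‿inverseˡ x)) , (λ x → ≈⇒≈ʷ (-‿inverseʳ x))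
            ; ⁻¹-cong = -‿congʷ
            }
          ; comm = λ x y → ≈⇒≈ʷ (+-comm x y)
          }
        ; *-cong = *-congʷ
        ; *-assoc = λ x y z → ≈⇒≈ʷ (*-assoc x y z)
        ; *-identity = (λ x → ≈⇒≈ʷ (*-identityˡ x)) , (λ x → ≈⇒≈ʷ (*-identityʳ x))
        ; distrib = (λ x y z → ≈⇒≈ʷ (distribˡ x y z)) , (λ x y z → ≈⇒≈ʷ (distribʳ x y z))
        }
      ; *-comm = λ x y → ≈⇒≈ʷ (*-comm x y)
      }
    }

  open import Algebra.Definitions.RawSemiring (Semiring.rawSemiring semiring) using (_∣_)

  w≈ʷ0 : w ≈ʷ 0#
  w≈ʷ0 = by 1# (sym (trans (+-identityˡ _) (*-identityˡ w)))

  ∣⇒≈ʷ0 : ∀ {x} → w ∣ x → x ≈ʷ 0#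
  ∣⇒≈ʷ0 (k , kw≈x) = by k (trans (sym kw≈x) (sym (+-identityˡ _)))

  ≈ʷ0⇒∣ : ∀ {x} → x ≈ʷ 0# → w ∣ x
  ≈ʷ0⇒∣ (by k x≈) = k , sym (trans x≈ (+-identityˡ _))

  ≈ʷ⇒∣- : ∀ {x y} → x ≈ʷ y → w ∣ x - y
  ≈ʷ⇒∣- {x} {y} x≈y =
    ≈ʷ0⇒∣ (transʷ (+-congʷ x≈y (≈⇒≈ʷ refl)) (≈⇒≈ʷ (-‿inverseʳ y)))

  ∣-⇒≈ʷ : ∀ {x y} → w ∣ x - y → x ≈ʷ y
  ∣-⇒≈ʷ {x} {y} (k , kw≈x-y) = by k (begin
    x               ≈⟨ +-identityʳ x ⟨
    x + 0#          ≈⟨ +-congˡ (-‿inverseʳ y) ⟨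
    x + (y - y)     ≈⟨ solve 3 (λ x y -y → x :+ (y :+ -y) := y :+ (x :+ -y)) refl x y (- y) ⟩
    y + (x - y)     ≈⟨ +-congˡ kw≈x-y ⟨
    y + k * w       ∎)

-- Coefficient lists form a commutative ring.

module PolynomialRing {c ℓ : Level} {q : ℕ} (F : FiniteField c ℓ q) where
  private module F = FiniteField F
  open Polynomials F hiding (_∣_; _∤_)
  open NaturalSolver F.commutativeSemiring using (solve; _:=_; _:+_)
  open RingProperties F.ring using (-0#≈0#)
  open SetoidReasoning F.setoid
  open _≈_ public

  infixr 8 _·_
  _·_ : F.Carrier → Poly → Poly
  a · p = map (a F.*_) p

  infix 9 -_
  -_ : Poly → Poly
  - p = map F.-_ p

  infixr 9 t·_
  t·_ : Poly → Poly
  t· p = F.0# ∷ p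

  coeff-+ : ∀ p q n → coeff (p + q) n F.≈ coeff p n F.+ coeff q n
  coeff-+ []      q       n       = F.sym (F.+-identityˡ _)
  coeff-+ (a ∷ p) []      n       = F.sym (F.+-identityʳ _)
  coeff-+ (a ∷ p) (b ∷ q) zero    = F.refl
  coeff-+ (a ∷ p) (b ∷ q) (suc n) = coeff-+ p q n

  coeff-· : ∀ a p n → coeff (a · p) n F.≈ a F.* coeff p n
  coeff-· a []      n       = F.sym (F.zeroʳ a)
  coeff-· a (b ∷ p) zero    = F.refl
  coeff-· a (b ∷ p) (suc n) = coeff-· a p n

  coeff-neg : ∀ p n → coeff (- p) n F.≈ F.- coeff p n
  coeff-neg []      n       = F.sym -0#≈0#
  coeff-neg (b ∷ p) zero    = F.refl
  coeff-neg (b ∷ p) (suc n) = coeff-neg p n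

  ≈-refl : ∀ {p} → p ≈ p
  ≈-refl = mk≈ λ _ → F.refl

  ≈-sym : ∀ {p q} → p ≈ q → q ≈ p
  ≈-sym (mk≈ e) = mk≈ λ n → F.sym (e n)

  ≈-trans : ∀ {p q r} → p ≈ q → q ≈ r → p ≈ r
  ≈-trans (mk≈ e) (mk≈ f) = mk≈ λ n → F.trans (e n) (f n)

  ∷-cong : ∀ {a b p q} → a F.≈ b → p ≈ q → a ∷ p ≈ b ∷ q
  ∷-cong a≈b (mk≈ e) = mk≈ λ { zero → a≈b ; (suc n) → e n }

  ∷-injectiveˡ : ∀ {a b p q} → a ∷ p ≈ b ∷ q → a F.≈ b
  ∷-injectiveˡ e = coeff-≈ e 0

  ∷-injectiveʳ : ∀ {a b p q} → a ∷ p ≈ b ∷ q → p ≈ q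
  ∷-injectiveʳ e = mk≈ λ n → coeff-≈ e (suc n)

  ∷-≈0 : ∀ {a p} → a F.≈ F.0# → p ≈ 0# → a ∷ p ≈ 0#
  ∷-≈0 a≈0 (mk≈ e) = mk≈ λ { zero → a≈0 ; (suc n) → e n }

  ∷≈0ˡ : ∀ {a p} → a ∷ p ≈ 0# → a F.≈ F.0#
  ∷≈0ˡ e = coeff-≈ e 0

  ∷≈0ʳ : ∀ {a p} → a ∷ p ≈ 0# → p ≈ 0#
  ∷≈0ʳ e = mk≈ λ n → coeff-≈ e (suc n)

  +-cong : ∀ {p q r s} → p ≈ q → r ≈ s → p + r ≈ q + s
  +-cong {p} {q} {r} {s} (mk≈ e) (mk≈ f) = mk≈ λ n → begin
    coeff (p + r) n          ≈⟨ coeff-+ p r n ⟩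
    coeff p n F.+ coeff r n  ≈⟨ F.+-cong (e n) (f n) ⟩
    coeff q n F.+ coeff s n  ≈⟨ coeff-+ q s n ⟨
    coeff (q + s) n          ∎

  ·-cong : ∀ {a b p q} → a F.≈ b → p ≈ q → a · p ≈ b · q
  ·-cong {a} {b} {p} {q} a≈b (mk≈ e) = mk≈ λ n → begin
    coeff (a · p) n  ≈⟨ coeff-· a p n ⟩
    a F.* coeff p n  ≈⟨ F.*-cong a≈b (e n) ⟩
    b F.* coeff q n  ≈⟨ coeff-· b q n ⟨
    coeff (b · q) n  ∎

  neg-cong : ∀ {p q} → p ≈ q → - p ≈ - q
  neg-cong {p} {q} (mk≈ e) = mk≈ λ n →
    F.trans (coeff-neg p n) (F.trans (F.-‿cong (e n)) (F.sym (coeff-neg q n)))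

  +-assoc : ∀ p q r → p + q + r ≈ p + (q + r)
  +-assoc p q r = mk≈ λ n → begin
    coeff (p + q + r) n                          ≈⟨ coeff-+ (p + q) r n ⟩
    coeff (p + q) n F.+ coeff r n                ≈⟨ F.+-congʳ (coeff-+ p q n) ⟩
    coeff p n F.+ coeff q n F.+ coeff r n        ≈⟨ F.+-assoc _ _ _ ⟩
    coeff p n F.+ (coeff q n F.+ coeff r n)      ≈⟨ F.+-congˡ (coeff-+ q r n) ⟨
    coeff p n F.+ coeff (q + r) n                ≈⟨ coeff-+ p (q + r) n ⟨
    coeff (p + (q + r)) n                        ∎

  +-comm : ∀ p q → p + q ≈ q + p
  +-comm p q = mk≈ λ n →
    F.trans (coeff-+ p q n) (F.trans (F.+-comm _ _) (F.sym (coeff-+ q p n)))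

  +-identityˡ : ∀ p → 0# + p ≈ p
  +-identityˡ p = ≈-refl

  +-identityʳ : ∀ p → p + 0# ≈ p
  +-identityʳ p = ≈-trans (+-comm p 0#) ≈-refl

  +-inverseʳ : ∀ p → p + - p ≈ 0#
  +-inverseʳ p = mk≈ λ n → begin
    coeff (p + - p) n              ≈⟨ coeff-+ p (- p) n ⟩
    coeff p n F.+ coeff (- p) n    ≈⟨ F.+-congˡ (coeff-neg p n) ⟩
    coeff p n F.- coeff p n        ≈⟨ F.-‿inverseʳ _ ⟩
    F.0#                           ∎

  +-inverseˡ : ∀ p → - p + p ≈ 0#
  +-inverseˡ p = ≈-trans (+-comm (- p) p) (+-inverseʳ p)

  +-interchange : ∀ p q r s → (p + q) + (r + s) ≈ (p + r) + (q + s)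
  +-interchange p q r s = mk≈ λ n → begin
    coeff ((p + q) + (r + s)) n  ≈⟨ expand p q r s n ⟩
    (coeff p n F.+ coeff q n) F.+ (coeff r n F.+ coeff s n)
      ≈⟨ solve 4 (λ p q r s → (p :+ q) :+ (r :+ s) := (p :+ r) :+ (q :+ s)) F.refl _ _ _ _ ⟩
    (coeff p n F.+ coeff r n) F.+ (coeff q n F.+ coeff s n)  ≈⟨ expand p r q s n ⟨
    coeff ((p + r) + (q + s)) n  ∎
    where
    expand : ∀ p q r s n → coeff ((p + q) + (r + s)) n
      F.≈ (coeff p n F.+ coeff q n) F.+ (coeff r n F.+ coeff s n)
    expand p q r s n = F.trans (coeff-+ (p + q) (r + s) n)
      (F.+-cong (coeff-+ p q n) (coeff-+ r s n))

  +-leftComm : ∀ p q r → p + (q + r) ≈ q + (p + r)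
  +-leftComm p q r = ≈-trans (≈-sym (+-assoc p q r))
    (≈-trans (+-cong (+-comm p q) ≈-refl) (+-assoc q p r))

  ·-zeroˡ : ∀ {a} p → a F.≈ F.0# → a · p ≈ 0#
  ·-zeroˡ {a} p a≈0 = mk≈ λ n →
    F.trans (coeff-· a p n) (F.trans (F.*-congʳ a≈0) (F.zeroˡ _))

  ·-identityˡ : ∀ p → F.1# · p ≈ p
  ·-identityˡ p = mk≈ λ n → F.trans (coeff-· F.1# p n) (F.*-identityˡ _)

  ·-distribˡ-+ : ∀ a p q → a · (p + q) ≈ a · p + a · q
  ·-distribˡ-+ a p q = mk≈ λ n → begin
    coeff (a · (p + q)) n                      ≈⟨ coeff-· a (p + q) n ⟩
    a F.* coeff (p + q) n                      ≈⟨ F.*-congˡ (coeff-+ p q n) ⟩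
    a F.* (coeff p n F.+ coeff q n)            ≈⟨ F.distribˡ _ _ _ ⟩
    a F.* coeff p n F.+ a F.* coeff q n        ≈⟨ F.+-cong (coeff-· a p n) (coeff-· a q n) ⟨
    coeff (a · p) n F.+ coeff (a · q) n        ≈⟨ coeff-+ (a · p) (a · q) n ⟨
    coeff (a · p + a · q) n                    ∎

  ·-assoc : ∀ a b p → (a F.* b) · p ≈ a · (b · p)
  ·-assoc a b p = mk≈ λ n → begin
    coeff ((a F.* b) · p) n       ≈⟨ coeff-· (a F.* b) p n ⟩
    a F.* b F.* coeff p n         ≈⟨ F.*-assoc a b _ ⟩
    a F.* (b F.* coeff p n)       ≈⟨ F.*-congˡ (coeff-· b p n) ⟨
    a F.* coeff (b · p) n         ≈⟨ coeff-· a (b · p) n ⟨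
    coeff (a · (b · p)) n         ∎

  t·-+ : ∀ p q → t· (p + q) ≈ t· p + t· q
  t·-+ p q = ∷-cong (F.sym (F.+-identityˡ F.0#)) ≈-refl

  *-zeroʳ : ∀ p → p * 0# ≈ 0#
  *-zeroʳ []      = ≈-refl
  *-zeroʳ (a ∷ p) = ∷-≈0 F.refl (*-zeroʳ p)

  *-congˡ : ∀ p {r s} → r ≈ s → p * r ≈ p * s
  *-congˡ []      r≈s = ≈-refl
  *-congˡ (a ∷ p) r≈s = +-cong (·-cong F.refl r≈s) (∷-cong F.refl (*-congˡ p r≈s))

  -- The mirror image of the recursion defining `_*_`, which unfolds only the left factor;
  -- commutativity then follows by induction.
  *-∷ : ∀ p b q → p * (b ∷ q) ≈ b · p + t· (p * q)
  *-∷ []      b q = ≈-sym (∷-≈0 F.refl ≈-refl)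
  *-∷ (a ∷ p) b q = ∷-cong (F.+-congʳ (F.*-comm a b))
    (≈-trans (+-cong (≈-refl {a · q}) (*-∷ p b q)) (+-leftComm (a · q) (b · p) _))

  *-comm : ∀ p q → p * q ≈ q * p
  *-comm []      q = ≈-sym (*-zeroʳ q)
  *-comm (a ∷ p) q = ≈-trans (+-cong (≈-refl {a · q}) (∷-cong F.refl (*-comm p q)))
    (≈-sym (*-∷ q a p))

  *-cong : ∀ {p q r s} → p ≈ q → r ≈ s → p * r ≈ q * s
  *-cong {p} {q} {r} {s} p≈q r≈s = ≈-trans (*-congˡ p r≈s)
    (≈-trans (*-comm p s) (≈-trans (*-congˡ s p≈q) (*-comm s q)))

  distribˡ : ∀ p q r → p * (q + r) ≈ p * q + p * r
  distribˡ []      q r = ≈-refl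
  distribˡ (a ∷ p) q r = ≈-trans
    (+-cong (·-distribˡ-+ a q r) (≈-trans (∷-cong F.refl (distribˡ p q r)) (t·-+ (p * q) (p * r))))
    (+-interchange (a · q) (a · r) (t· (p * q)) (t· (p * r)))

  distribʳ : ∀ r p q → (p + q) * r ≈ p * r + q * r
  distribʳ r p q = ≈-trans (*-comm (p + q) r)
    (≈-trans (distribˡ r p q) (+-cong (*-comm r p) (*-comm r q)))

  ·-*-assoc : ∀ a p q → (a · p) * q ≈ a · (p * q)
  ·-*-assoc a []      q = ≈-refl
  ·-*-assoc a (b ∷ p) q = ≈-trans
    (+-cong (·-assoc a b q) (∷-cong (F.sym (F.zeroʳ a)) (·-*-assoc a p q)))
    (≈-sym (·-distribˡ-+ a (b · q) (t· (p * q))))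

  t·-* : ∀ p q → t· p * q ≈ t· (p * q)
  t·-* p q = +-cong (·-zeroˡ q F.refl) ≈-refl

  *-assoc : ∀ p q r → (p * q) * r ≈ p * (q * r)
  *-assoc []      q r = ≈-refl
  *-assoc (a ∷ p) q r = ≈-trans (distribʳ r (a · q) (t· (p * q)))
    (+-cong (·-*-assoc a q r) (≈-trans (t·-* (p * q) r) (∷-cong F.refl (*-assoc p q r))))

  const-* : ∀ a p → (a ∷ []) * p ≈ a · p
  const-* a p = ≈-trans (+-cong (≈-refl {a · p}) (∷-≈0 F.refl ≈-refl)) (+-identityʳ _)

  *-identityˡ : ∀ p → 1# * p ≈ p
  *-identityˡ p = ≈-trans (const-* F.1# p) (·-identityˡ p)

  polynomialRing : CommutativeRing c ℓ
  polynomialRing = record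
    { Carrier = Poly
    ; _≈_     = _≈_
    ; _+_     = _+_
    ; _*_     = _*_
    ; -_      = -_
    ; 0#      = 0#
    ; 1#      = 1#
    ; isCommutativeRing = record
      { isRing = record
        { +-isAbelianGroup = record
          { isGroup = record
            { isMonoid = record
              { isSemigroup = record
                { isMagma = record
                  { isEquivalence = record { refl = ≈-refl ; sym = ≈-sym ; trans = ≈-trans }
                  ; ∙-cong = +-cong
                  }
                ; assoc = +-assoc
                }
              ; identity = +-identityˡ , +-identityʳ
              }
            ; inverse = +-inverseˡ , +-inverseʳ
            ; ⁻¹-cong = neg-cong
            }
          ; comm = +-comm
          }
        ; *-cong = *-cong
        ; *-assoc = *-assoc
        ; *-identity = *-identityˡ , λ p → ≈-trans (*-comm p 1#) (*-identityˡ p)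
        ; distrib = distribˡ , distribʳ
        }
      ; *-comm = *-comm
      }
    }

-- Degree bounds, leading coefficients and cancellation in F[t].

module Degrees {c ℓ : Level} {q : ℕ} (F : FiniteField c ℓ q) where
  private module F = FiniteField F
  open Polynomials F
  open PolynomialRing F
  open Exp (CommutativeRing.commutativeSemiring polynomialRing) using (_^_)
  open RingProperties F.ring using (-0#≈0#)

  *-cancelˡ-0 : ∀ {a b} → a F.≉ F.0# → a F.* b F.≈ F.0# → b F.≈ F.0#
  *-cancelˡ-0 {a} {b} a≉0 ab≈0 = begin
    b                   ≈⟨ F.*-identityˡ b ⟨
    F.1# F.* b          ≈⟨ F.*-congʳ (F.trans (F.*-comm a⁻¹ a) aa⁻¹≈1) ⟨
    a⁻¹ F.* a F.* b     ≈⟨ F.*-assoc a⁻¹ a b ⟩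
    a⁻¹ F.* (a F.* b)   ≈⟨ F.*-congˡ ab≈0 ⟩
    a⁻¹ F.* F.0#        ≈⟨ F.zeroʳ a⁻¹ ⟩
    F.0#                ∎
    where
    open SetoidReasoning F.setoid
    a⁻¹ = proj₁ (F.inverse a a≉0)
    aa⁻¹≈1 = proj₂ (F.inverse a a≉0)

  *-≉0 : ∀ {a b} → a F.≉ F.0# → b F.≉ F.0# → a F.* b F.≉ F.0#
  *-≉0 a≉0 b≉0 ab≈0 = b≉0 (*-cancelˡ-0 a≉0 ab≈0)

  -- A strict degree bound that is insensitive to trailing zeros and includes the zero polynomial,
  -- to which `deg` gives only a junk value.
  record Below (p : Poly) (n : ℕ) : Set ℓ where
    constructor below
    field
      vanish : ∀ m → n ℕ.≤ m → coeff p m F.≈ F.0#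

  open Below public

  below-cong : ∀ {p r n} → p ≈ r → Below p n → Below r n
  below-cong p≈r (below v) = below λ m n≤m → F.trans (F.sym (coeff-≈ p≈r m)) (v m n≤m)

  below-mono : ∀ {p m n} → m ℕ.≤ n → Below p m → Below p n
  below-mono m≤n (below v) = below λ k n≤k → v k (ℕ.≤-trans m≤n n≤k)

  below-+ : ∀ {p r n} → Below p n → Below r n → Below (p + r) n
  below-+ {p} {r} (below u) (below v) = below λ m n≤m →
    F.trans (coeff-+ p r m) (F.trans (F.+-cong (u m n≤m) (v m n≤m)) (F.+-identityˡ _))

  below-· : ∀ {p n} a → Below p n → Below (a · p) n
  below-· {p} a (below v) = below λ m n≤m →
    F.trans (coeff-· a p m) (F.trans (F.*-congˡ (v m n≤m)) (F.zeroʳ a))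

  below-neg : ∀ {p n} → Below p n → Below (- p) n
  below-neg {p} (below v) = below λ m n≤m →
    F.trans (coeff-neg p m) (F.trans (F.-‿cong (v m n≤m)) -0#≈0#)

  below-∷ : ∀ {a p n} → Below p n → Below (a ∷ p) (suc n)
  below-∷ (below v) = below λ { (suc m) (s≤s n≤m) → v m n≤m }

  below-tail : ∀ {a p n} → Below (a ∷ p) (suc n) → Below p n
  below-tail (below v) = below λ m n≤m → v (suc m) (s≤s n≤m)

  below-0 : ∀ {p} → Below p 0 → p ≈ 0#
  below-0 (below v) = mk≈ λ n → v n z≤n

  0-below : ∀ {p n} → p ≈ 0# → Below p n
  0-below (mk≈ e) = below λ m _ → e m

  -- The coefficient a may vanish, so that n is in general only an upper bound for the degree.
  record Leading (p : Poly) (n : ℕ) (a : F.Carrier) : Set ℓ where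
    constructor leading
    field
      coefficient : coeff p n F.≈ a
      above       : Below p (suc n)

  open Leading public

  leading-cong : ∀ {p r n a} → p ≈ r → Leading p n a → Leading r n a
  leading-cong p≈r (leading e b) =
    leading (F.trans (F.sym (coeff-≈ p≈r _)) e) (below-cong p≈r b)

  leading-+ : ∀ {p r n a} → Leading p n a → Below r n → Leading (p + r) n a
  leading-+ {p} {r} {n} (leading e b) (below v) = leading
    (F.trans (coeff-+ p r n) (F.trans (F.+-cong e (v n ℕ.≤-refl)) (F.+-identityʳ _)))
    (below-+ b (below-mono (ℕ.n≤1+n n) (below v)))

  leading-· : ∀ {p n b} a → Leading p n b → Leading (a · p) n (a F.* b)
  leading-· {p} {n} a (leading e b) =
    leading (F.trans (coeff-· a p n) (F.*-congˡ e)) (below-· a b)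

  leading-∷ : ∀ {a p n b} → Leading p n b → Leading (a ∷ p) (suc n) b
  leading-∷ (leading e b) = leading e (below-∷ b)

  leading-* : ∀ {p r m n a b} → Leading p m a → Leading r n b →
              Leading (p * r) (m ℕ.+ n) (a F.* b)
  leading-* {[]} (leading 0≈a _) _ =
    leading (F.sym (F.trans (F.*-congʳ (F.sym 0≈a)) (F.zeroˡ _))) (0-below ≈-refl)
  leading-* {x ∷ p} {r} {zero} {n} {a} {b} (leading x≈a above) lr =
    leading-cong x·r≈ (leading-·-≈ (leading-· x lr))
    where
    p≈0 = below-0 (below-tail above)
    x·r≈ : x · r ≈ (x ∷ p) * r
    x·r≈ = ≈-sym (≈-trans
      (+-cong (≈-refl {x · r}) (∷-≈0 F.refl (*-cong p≈0 (≈-refl {r})))) (+-identityʳ _))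
    leading-·-≈ : Leading (x · r) n (x F.* b) → Leading (x · r) n (a F.* b)
    leading-·-≈ (leading e v) = leading (F.trans e (F.*-congʳ x≈a)) v
  -- In `x · r + t· (p * r)` the second summand carries the top coefficient: `x · r` stops at degree
  -- n, below `suc m + n`.
  leading-* {x ∷ p} {r} {suc m} {n} (leading e above) lr = leading-cong
    (+-comm (t· (p * r)) (x · r))
    (leading-+ (leading-∷ (leading-* (leading e (below-tail above)) lr))
      (below-mono (s≤s (ℕ.m≤n+m n m)) (below-· x (Leading.above lr))))

  leading-1 : Leading 1# 0 F.1#
  leading-1 = leading F.refl (below-∷ (0-below ≈-refl))

  MonicOfDegree : Poly → ℕ → Set ℓ
  MonicOfDegree p n = Leading p n F.1#

  monic-* : ∀ {p r m n} → MonicOfDegree p m → MonicOfDegree r n →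
            MonicOfDegree (p * r) (m ℕ.+ n)
  monic-* lp lr with leading e b ← leading-* lp lr =
    leading (F.trans e (F.*-identityˡ F.1#)) b

  monic-^ : ∀ {p m} k → MonicOfDegree p m → MonicOfDegree (p ^ k) (k ℕ.* m)
  monic-^ zero    lp = leading-1
  monic-^ (suc k) lp = monic-* lp (monic-^ k lp)

  -- Decidable equality in the field strips the trailing zeros, so the exact degree becomes
  -- available, in contrast to the upper bound in `Leading`.
  zeroOrLeading : ∀ p → p ≈ 0# ⊎ ∃₂ λ n a → a F.≉ F.0# × Leading p n a
  zeroOrLeading [] = inj₁ ≈-refl
  zeroOrLeading (x ∷ p) with zeroOrLeading p
  ... | inj₂ (n , a , a≉0 , lp) = inj₂ (suc n , a , a≉0 , leading-∷ lp)
  ... | inj₁ p≈0 with x F.≈? F.0#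
  ...   | yes x≈0 = inj₁ (∷-≈0 x≈0 p≈0)
  ...   | no  x≉0 = inj₂ (0 , x , x≉0 , leading F.refl (below-∷ (0-below p≈0)))

  leading-≉0 : ∀ {p n a} → a F.≉ F.0# → Leading p n a → p ≉ 0#
  leading-≉0 a≉0 (leading e _) p≈0 = a≉0 (F.trans (F.sym e) (coeff-≈ p≈0 _))

  leading-below : ∀ {p m n a} → a F.≉ F.0# → Leading p m a → Below p n → m ℕ.< n
  leading-below {m = m} {n} a≉0 (leading e _) (below v) with m ℕ.<? n
  ... | yes m<n = m<n
  ... | no  m≮n = contradiction (F.trans (F.sym e) (v m (ℕ.≮⇒≥ m≮n))) a≉0

  leading-unique : ∀ {p m n a b} → a F.≉ F.0# → b F.≉ F.0# →
                   Leading p m a → Leading p n b → m ≡ n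
  leading-unique a≉0 b≉0 lm ln = ℕ.≤-antisym
    (ℕ.s≤s⁻¹ (leading-below a≉0 lm (above ln))) (ℕ.s≤s⁻¹ (leading-below b≉0 ln (above lm)))

  leading-cancel : ∀ {p r n a} → Leading p n a → Leading r n a → Below (p + - r) n
  leading-cancel {p} {r} {n} {a} (leading e (below u)) (leading f (below v)) = below λ m n≤m →
    F.trans (coeff-+ p (- r) m) (F.trans (F.+-congˡ (coeff-neg r m)) (F.trans
      (F.+-congʳ (agree m (ℕ.m≤n⇒m<n∨m≡n n≤m))) (F.-‿inverseʳ _)))
    where
    agree : ∀ m → n ℕ.< m ⊎ n ≡ m → coeff p m F.≈ coeff r m
    agree m (inj₁ n<m)    = F.trans (u m n<m) (F.sym (v m n<m))
    agree m (inj₂ ≡.refl) = F.trans e (F.sym f)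

  p*r≈0⇒r≈0 : ∀ {p r} → p ≉ 0# → p * r ≈ 0# → r ≈ 0#
  p*r≈0⇒r≈0 {p} {r} p≉0 pr≈0 with zeroOrLeading p | zeroOrLeading r
  ... | inj₁ p≈0                | _        = contradiction p≈0 p≉0
  ... | _                       | inj₁ r≈0 = r≈0
  ... | inj₂ (_ , _ , a≉0 , lp) | inj₂ (_ , _ , b≉0 , lr) =
    contradiction pr≈0 (leading-≉0 (*-≉0 a≉0 b≉0) (leading-* lp lr))

  -- The bridge from coefficient conditions to the list recursion of `deg`, whose test for an
  -- all-zero tail is decided by the position of the leading term.
  deg-leading : ∀ {p n a} → a F.≉ F.0# → Leading p n a → deg p ≡ n
  deg-leading {[]} a≉0 (leading e _) = contradiction (F.sym e) a≉0
  deg-leading {x ∷ p} a≉0 lp with all? (F._≈? F.0#) p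
  deg-leading {x ∷ p} {zero} a≉0 lp | yes ps≈0 = ≡.refl
  deg-leading {x ∷ p} {suc n} a≉0 lp | yes ps≈0 =
    contradiction (F.trans (F.sym (coefficient lp)) (all≈0 ps≈0 n)) a≉0
    where
    all≈0 : ∀ {p} → All (F._≈ F.0#) p → ∀ n → coeff p n F.≈ F.0#
    all≈0 []       n       = F.refl
    all≈0 (e ∷ es) zero    = e
    all≈0 (e ∷ es) (suc n) = all≈0 es n
  deg-leading {x ∷ p} {zero} a≉0 lp | no ¬ps≈0 =
    contradiction (≈0-all (below-0 (below-tail (above lp)))) ¬ps≈0
    where
    ≈0-all : ∀ {p} → p ≈ 0# → All (F._≈ F.0#) p
    ≈0-all {[]}    p≈0 = []
    ≈0-all {y ∷ p} p≈0 = ∷≈0ˡ p≈0 ∷ ≈0-all (∷≈0ʳ p≈0)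
  deg-leading {x ∷ p} {suc n} a≉0 (leading e b) | no ¬ps≈0 =
    ≡.cong suc (deg-leading a≉0 (leading e (below-tail b)))

  const∣1 : ∀ {p a} → a F.≉ F.0# → Leading p 0 a → p ∣ 1#
  const∣1 {p} {a} a≉0 lp@(leading e b) = (a⁻¹ ∷ []) , ≈-trans (const-* a⁻¹ p) (mk≈ λ
    { zero → F.trans (coeff-· a⁻¹ p 0) (F.trans (F.*-congˡ e) (F.trans (F.*-comm a⁻¹ a) aa⁻¹≈1))
    ; (suc n) → vanish (below-· a⁻¹ b) (suc n) (s≤s z≤n) })
    where
    a⁻¹ = proj₁ (F.inverse a a≉0)
    aa⁻¹≈1 = proj₂ (F.inverse a a≉0)

  ∣-degree : ∀ {p r m n a b} → a F.≉ F.0# → b F.≉ F.0# → Leading p m a → Leading r n b →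
             p ∣ r → m ℕ.≤ n
  ∣-degree {n = n} a≉0 b≉0 lp lr (k , kp≈r) with zeroOrLeading k
  ... | inj₁ k≈0 = contradiction
    (≈-trans (≈-sym kp≈r) (*-cong k≈0 ≈-refl)) (leading-≉0 b≉0 lr)
  ... | inj₂ (l , _ , c≉0 , lk) = ≡.subst (_ ℕ.≤_)
    (leading-unique (*-≉0 c≉0 a≉0) b≉0 (leading-cong kp≈r (leading-* lk lp)) lr)
    (ℕ.m≤n+m _ l)

  monic∤1 : ∀ {p n} → 1 ℕ.≤ n → MonicOfDegree p n → p ∤ 1#
  monic∤1 1≤n lp p∣1 = ℕ.<⇒≱ 1≤n (∣-degree F.1≉0 F.1≉0 lp leading-1 p∣1)

-- Evaluation of polynomials along a homomorphism out of F.

module Evaluation {c ℓ a ℓ′ : Level} {q : ℕ} (F : FiniteField c ℓ q)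
  (A : CommutativeRing a ℓ′) (φ : FiniteField.Carrier F → CommutativeRing.Carrier A)
  (φ-hom : SemiringMorphisms.IsSemiringHomomorphism
    (Semiring.rawSemiring (FiniteField.semiring F))
    (Semiring.rawSemiring (CommutativeRing.semiring A)) φ) where
  private
    module F = FiniteField F
    module A = CommutativeRing A
    module φ = SemiringMorphisms.IsSemiringHomomorphism φ-hom
  open Polynomials F
  open PolynomialRing F
  open Exp (CommutativeRing.commutativeSemiring polynomialRing) using (_^_)
  open Exp A.commutativeSemiring using () renaming (_^_ to _^ᴬ_)
  open NaturalSolver A.commutativeSemiring using (solve; _:=_; _:+_; _:*_)
  open SetoidReasoning A.setoid

  -- Horner's scheme. With `φ` the identity it gives values at field elements; with `φ` the
  -- constants of F[t] it substitutes one polynomial into another.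
  eval : Poly → A.Carrier → A.Carrier
  eval []      z = A.0#
  eval (x ∷ p) z = φ x A.+ z A.* eval p z

  eval-0 : ∀ p z → p ≈ 0# → eval p z A.≈ A.0#
  eval-0 []      z p≈0 = A.refl
  eval-0 (x ∷ p) z p≈0 = begin
    φ x A.+ z A.* eval p z  ≈⟨ A.+-cong (A.trans (φ.⟦⟧-cong (∷≈0ˡ p≈0)) φ.0#-homo)
                                 (A.*-congˡ (eval-0 p z (∷≈0ʳ p≈0))) ⟩
    A.0# A.+ z A.* A.0#     ≈⟨ A.trans (A.+-identityˡ _) (A.zeroʳ z) ⟩
    A.0#                    ∎

  eval-cong : ∀ p r z → p ≈ r → eval p z A.≈ eval r z
  eval-cong []      r       z p≈r = A.sym (eval-0 r z (≈-sym p≈r))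
  eval-cong (x ∷ p) []      z p≈r = eval-0 (x ∷ p) z p≈r
  eval-cong (x ∷ p) (y ∷ r) z p≈r = A.+-cong (φ.⟦⟧-cong (∷-injectiveˡ p≈r))
    (A.*-congˡ (eval-cong p r z (∷-injectiveʳ p≈r)))

  eval-+ : ∀ p r z → eval (p + r) z A.≈ eval p z A.+ eval r z
  eval-+ []      r       z = A.sym (A.+-identityˡ _)
  eval-+ (x ∷ p) []      z = A.sym (A.+-identityʳ _)
  eval-+ (x ∷ p) (y ∷ r) z = begin
    φ (x F.+ y) A.+ z A.* eval (p + r) z
      ≈⟨ A.+-cong (φ.+-homo x y) (A.*-congˡ (eval-+ p r z)) ⟩
    (φ x A.+ φ y) A.+ z A.* (eval p z A.+ eval r z)
      ≈⟨ solve 5 (λ x y z p r → (x :+ y) :+ z :* (p :+ r) := (x :+ z :* p) :+ (y :+ z :* r))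
           A.refl (φ x) (φ y) z (eval p z) (eval r z) ⟩
    (φ x A.+ z A.* eval p z) A.+ (φ y A.+ z A.* eval r z)  ∎

  eval-· : ∀ x p z → eval (x · p) z A.≈ φ x A.* eval p z
  eval-· x []      z = A.sym (A.zeroʳ _)
  eval-· x (y ∷ p) z = begin
    φ (x F.* y) A.+ z A.* eval (x · p) z
      ≈⟨ A.+-cong (φ.*-homo x y) (A.*-congˡ (eval-· x p z)) ⟩
    φ x A.* φ y A.+ z A.* (φ x A.* eval p z)
      ≈⟨ solve 4 (λ x y z p → x :* y :+ z :* (x :* p) := x :* (y :+ z :* p))
           A.refl (φ x) (φ y) z (eval p z) ⟩
    φ x A.* (φ y A.+ z A.* eval p z)  ∎

  eval-* : ∀ p r z → eval (p * r) z A.≈ eval p z A.* eval r z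
  eval-* []      r z = A.sym (A.zeroˡ _)
  eval-* (x ∷ p) r z = begin
    eval (x · r + t· (p * r)) z
      ≈⟨ eval-+ (x · r) (t· (p * r)) z ⟩
    eval (x · r) z A.+ (φ F.0# A.+ z A.* eval (p * r) z)
      ≈⟨ A.+-cong (eval-· x r z) (A.trans (A.+-congʳ φ.0#-homo) (A.+-identityˡ _)) ⟩
    φ x A.* eval r z A.+ z A.* eval (p * r) z
      ≈⟨ A.+-congˡ (A.*-congˡ (eval-* p r z)) ⟩
    φ x A.* eval r z A.+ z A.* (eval p z A.* eval r z)
      ≈⟨ solve 4 (λ x r z p → x :* r :+ z :* (p :* r) := (x :+ z :* p) :* r)
           A.refl (φ x) (eval r z) z (eval p z) ⟩
    (φ x A.+ z A.* eval p z) A.* eval r z  ∎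

  eval-const : ∀ x z → eval (x ∷ []) z A.≈ φ x
  eval-const x z = A.trans (A.+-congˡ (A.zeroʳ z)) (A.+-identityʳ _)

  eval-^ : ∀ p n z → eval (p ^ n) z A.≈ eval p z ^ᴬ n
  eval-^ p zero    z = A.trans (eval-const F.1# z) φ.1#-homo
  eval-^ p (suc n) z = A.trans (eval-* p (p ^ n) z) (A.*-congˡ (eval-^ p n z))

  X : Poly
  X = t· 1#

  eval-X : ∀ z → eval X z A.≈ z
  eval-X z = begin
    φ F.0# A.+ z A.* eval 1# z  ≈⟨ A.+-cong φ.0#-homo
                                    (A.*-congˡ (A.trans (eval-const F.1# z) φ.1#-homo)) ⟩
    A.0# A.+ z A.* A.1#         ≈⟨ A.trans (A.+-identityˡ _) (A.*-identityʳ z) ⟩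
    z                           ∎

-- A polynomial has at most as many roots as its degree.

module Roots {c ℓ : Level} {q : ℕ} (F : FiniteField c ℓ q) where
  private module F = FiniteField F
  open Polynomials F
  open PolynomialRing F
  open Degrees F
  open NaturalSolver F.commutativeSemiring using (solve; _:=_; _:+_; _:*_)
  open RingProperties F.ring using (x∙y⁻¹≈ε⇒x≈y; [y-z]x≈yx-zx; x≈y⇒x∙y⁻¹≈ε)
  open SetoidReasoning F.setoid

  open Evaluation F F.commutativeRing id
    (Identity.isSemiringHomomorphism (Semiring.rawSemiring F.semiring) F.refl) public

  -- The quotient of p − p(a) by t − a (synthetic division).
  divideByRoot : Poly → F.Carrier → Poly
  divideByRoot []      a = []
  divideByRoot (_ ∷ p) a = eval p a ∷ divideByRoot p a

  -- p(x) = p(a) + (x − a) s(x), with both sides moved so that no subtraction occurs.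
  eval-divideByRoot : ∀ p a x →
    eval p x F.+ a F.* eval (divideByRoot p a) x
      F.≈ eval p a F.+ x F.* eval (divideByRoot p a) x
  eval-divideByRoot []      a x = F.+-congˡ (F.trans (F.zeroʳ a) (F.sym (F.zeroʳ x)))
  eval-divideByRoot (y ∷ p) a x = begin
    y F.+ x F.* px F.+ a F.* (pa F.+ x F.* sx)
      ≈⟨ solve 6 (λ y x px a pa sx → y :+ x :* px :+ a :* (pa :+ x :* sx)
           := y :+ a :* pa :+ x :* (px :+ a :* sx)) F.refl y x px a pa sx ⟩
    y F.+ a F.* pa F.+ x F.* (px F.+ a F.* sx)
      ≈⟨ F.+-congˡ (F.*-congˡ (eval-divideByRoot p a x)) ⟩
    y F.+ a F.* pa F.+ x F.* (pa F.+ x F.* sx) ∎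
    where
    px = eval p x
    pa = eval p a
    sx = eval (divideByRoot p a) x

  below-divideByRoot : ∀ {n} p a → Below p (suc n) → Below (divideByRoot p a) n
  below-divideByRoot {zero}  []      a b = 0-below ≈-refl
  below-divideByRoot {suc n} []      a b = 0-below ≈-refl
  below-divideByRoot {zero}  (x ∷ p) a b = 0-below (∷-≈0 (eval-0 p a p≈0)
    (below-0 (below-divideByRoot p a (0-below p≈0))))
    where p≈0 = below-0 (below-tail b)
  below-divideByRoot {suc n} (x ∷ p) a b = below-∷ (below-divideByRoot p a (below-tail b))

  -- The entries of the quotient are the values at a of the successive tails of p. When they vanish,
  -- each coefficient x equals x + a * `eval p a`, itself such a value or the value of the whole
  -- polynomial.
  divideByRoot≈0 : ∀ p a → divideByRoot p a ≈ 0# → eval p a F.≈ F.0# → p ≈ 0#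
  divideByRoot≈0 []      a s≈0 pa≈0 = ≈-refl
  divideByRoot≈0 (x ∷ p) a s≈0 pa≈0 = ∷-≈0 (begin
    x                       ≈⟨ F.+-identityʳ x ⟨
    x F.+ F.0#              ≈⟨ F.+-congˡ (F.trans (F.*-congˡ (∷≈0ˡ s≈0)) (F.zeroʳ a)) ⟨
    x F.+ a F.* eval p a    ≈⟨ pa≈0 ⟩
    F.0#                    ∎)
    (divideByRoot≈0 p a (∷≈0ʳ s≈0) (∷≈0ˡ s≈0))

  *-cancelʳ-≉ : ∀ {x a s} → ¬ (x F.≈ a) → a F.* s F.≈ x F.* s → s F.≈ F.0#
  *-cancelʳ-≉ {x} {a} {s} x≉a as≈xs = *-cancelˡ-0
    (λ a-x≈0 → x≉a (F.sym (x∙y⁻¹≈ε⇒x≈y a x a-x≈0)))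
    (F.trans ([y-z]x≈yx-zx s a x) (x≈y⇒x∙y⁻¹≈ε as≈xs))

  tooManyRoots : ∀ n (a : Fin n → F.Carrier) → Injective _≡_ F._≈_ a → ∀ p →
                 Below p n → (∀ i → eval p (a i) F.≈ F.0#) → p ≈ 0#
  tooManyRoots zero    a a-inj p b roots = below-0 b
  tooManyRoots (suc n) a a-inj p b roots = divideByRoot≈0 p a₀ s≈0 (roots zero)
    where
    a₀ = a zero
    s = divideByRoot p a₀
    s-root : ∀ i → eval s (a (suc i)) F.≈ F.0#
    s-root i = *-cancelʳ-≉ {x = a (suc i)} {a = a₀} (λ e → contradiction (a-inj e) λ ()) (begin
      a₀ F.* sx              ≈⟨ F.+-identityˡ _ ⟨
      F.0# F.+ a₀ F.* sx     ≈⟨ F.+-congʳ (roots (suc i)) ⟨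
      eval p x F.+ a₀ F.* sx ≈⟨ eval-divideByRoot p a₀ x ⟩
      eval p a₀ F.+ x F.* sx ≈⟨ F.+-congʳ (roots zero) ⟩
      F.0# F.+ x F.* sx      ≈⟨ F.+-identityˡ _ ⟩
      x F.* sx               ∎)
      where
      x = a (suc i)
      sx = eval s x
    s≈0 : s ≈ 0#
    s≈0 = tooManyRoots n (a ∘ suc) (Fin.suc-injective ∘ a-inj) s (below-divideByRoot p a₀ b) s-root

  encode : F.Carrier → Fin q
  encode = Bijection.to F.enumeration

  decode : Fin q → F.Carrier
  decode = Bijection.to⁻ F.enumeration

  encode-decode : ∀ i → encode (decode i) ≡ i
  encode-decode i = proj₂ (Bijection.surjective F.enumeration i) F.refl

  decode-encode : ∀ x → decode (encode x) F.≈ x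
  decode-encode x = Bijection.injective F.enumeration (encode-decode (encode x))

  encode-cong : ∀ {x y} → x F.≈ y → encode x ≡ encode y
  encode-cong = Bijection.cong F.enumeration

  decode-injective : Injective _≡_ F._≈_ decode
  decode-injective {i} {j} e =
    ≡.trans (≡.sym (encode-decode i)) (≡.trans (encode-cong e) (encode-decode j))

  vanishing⇒≈0 : ∀ p → Below p q → (∀ x → eval p x F.≈ F.0#) → p ≈ 0#
  vanishing⇒≈0 p b roots = tooManyRoots q decode decode-injective p b (roots ∘ decode)

-- Fermat's theorem in a field of q elements.

module Fermat {c ℓ : Level} {q : ℕ} (F : FiniteField c ℓ q) where
  open FiniteField F hiding (zero)
  open Roots F using (encode; decode; encode-decode; decode-encode; encode-cong)
  open Degrees F using (*-≉0; *-cancelˡ-0)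
  open Exp commutativeSemiring using (_^_; ^-congˡ)
  open Sum *-commutativeMonoid using ()
    renaming (sum to product; sum-permute to product-permute; ∑-distrib-+ to product-distrib-*;
      sum-cong-≋ to product-cong; sum-replicate to product-replicate;
      sum-replicate-zero to product-1)
  open RingProperties ring using (x∙y⁻¹≈ε⇒x≈y; [y-z]x≈yx-zx; x≈y⇒x∙y⁻¹≈ε)
  open SetoidReasoning setoid

  2≤q : 2 ℕ.≤ q
  2≤q = distinct⇒2≤ (encode 0#) (encode 1#) λ e → 1≉0 (Bijection.injective enumeration (≡.sym e))
    where
    distinct⇒2≤ : ∀ {n} (i j : Fin n) → i ≢ j → 2 ℕ.≤ n
    distinct⇒2≤ {suc zero}    zero zero i≢j = contradiction ≡.refl i≢j
    distinct⇒2≤ {suc (suc n)} _    _    _   = s≤s (s≤s z≤n)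

  0^n≈0 : ∀ n → 1 ℕ.≤ n → 0# ^ n ≈ 0#
  0^n≈0 (suc n) _ = zeroˡ _

  product-≉0 : ∀ {n} (f : Fin n → Carrier) → (∀ i → f i ≉ 0#) → product f ≉ 0#
  product-≉0 {zero}  f f≉0 = 1≉0
  product-≉0 {suc n} f f≉0 = *-≉0 (f≉0 zero) (product-≉0 (f ∘ suc) (f≉0 ∘ suc))

  product-single : ∀ {n} (f : Fin n → Carrier) i₀ → (∀ i → i ≢ i₀ → f i ≈ 1#) →
                   product f ≈ f i₀
  product-single {suc n} f zero f≈1 = begin
    f zero * product (f ∘ suc)           ≈⟨ *-congˡ (product-cong λ i → f≈1 (suc i) λ ()) ⟩
    f zero * product {n} (λ _ → 1#)      ≈⟨ *-congˡ (product-1 n) ⟩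
    f zero * 1#                          ≈⟨ *-identityʳ _ ⟩
    f zero                               ∎
  product-single {suc n} f (suc i₀) f≈1 = begin
    f zero * product (f ∘ suc)  ≈⟨ *-cong (f≈1 zero λ ())
      (product-single (f ∘ suc) i₀ λ i i≢ → f≈1 (suc i) (i≢ ∘ Fin.suc-injective)) ⟩
    1# * f (suc i₀)             ≈⟨ *-identityˡ _ ⟩
    f (suc i₀)                  ∎

  private
    caseZero : Carrier → Carrier → Carrier → Carrier
    caseZero x u v with x ≈? 0#
    ... | yes _ = u
    ... | no  _ = v

    caseZero-yes : ∀ {x} u v → x ≈ 0# → caseZero x u v ≈ u
    caseZero-yes {x} u v x≈0 with x ≈? 0#
    ... | yes _   = refl
    ... | no  x≉0 = contradiction x≈0 x≉0

    caseZero-no : ∀ {x} u v → x ≉ 0# → caseZero x u v ≈ v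
    caseZero-no {x} u v x≉0 with x ≈? 0#
    ... | yes x≈0 = contradiction x≈0 x≉0
    ... | no  _   = refl

  -- Multiplication by a unit a permutes the field.  Comparing the product of all non-zero
  -- elements before and after gives ∏_{x ≉ 0} a = 1; the zero element supplies the last factor a.
  fermat-unit : ∀ {a} → a ≉ 0# → a ^ q ≈ a
  fermat-unit {a} a≉0 = begin
    a ^ q                            ≈⟨ product-replicate q ⟨
    product {q} (λ _ → a)            ≈⟨ product-cong a≈gh ⟩
    product (λ i → g i * h i)        ≈⟨ product-distrib-* g h ⟩
    product g * product h            ≈⟨ *-cong ∏g≈1 ∏h≈a ⟩
    1# * a                           ≈⟨ *-identityˡ a ⟩
    a                                ∎
    where
    a⁻¹ = proj₁ (inverse a a≉0)
    aa⁻¹≈1 = proj₂ (inverse a a≉0)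
    -- `f` replaces the zero element by 1, so that its product runs over the units; `g` and `h`
    -- distribute the q factors a of `a ^ q` between the units and the zero element.
    f g h : Fin q → Carrier
    f i = caseZero (decode i) 1# (decode i)
    g i = caseZero (decode i) 1# a
    h i = caseZero (decode i) a 1#

    scale : Carrier → Fin q → Fin q
    scale x i = encode (x * decode i)

    scale-inverse : ∀ {x y} → x * y ≈ 1# → ∀ {i} → scale x (scale y i) ≡ i
    scale-inverse {x} {y} xy≈1 {i} = ≡.trans (encode-cong (begin
      x * decode (scale y i)   ≈⟨ *-congˡ (decode-encode _) ⟩
      x * (y * decode i)       ≈⟨ *-assoc x y _ ⟨
      x * y * decode i         ≈⟨ *-congʳ xy≈1 ⟩
      1# * decode i            ≈⟨ *-identityˡ _ ⟩
      decode i                 ∎)) (encode-decode i)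

    π : Permutation q q
    π = permutation (scale a) (scale a⁻¹)
      (λ i → scale-inverse aa⁻¹≈1 {i})
      (λ i → scale-inverse (trans (*-comm a⁻¹ a) aa⁻¹≈1) {i})

    f∘π≈gf : ∀ i → f (scale a i) ≈ g i * f i
    f∘π≈gf i with decode i ≈? 0#
    ... | yes x≈0 = trans (caseZero-yes _ _ (begin
      decode (scale a i)  ≈⟨ decode-encode _ ⟩
      a * decode i        ≈⟨ *-congˡ x≈0 ⟩
      a * 0#              ≈⟨ zeroʳ a ⟩
      0#                  ∎)) (sym (*-identityˡ 1#))
    ... | no  x≉0 = trans
      (caseZero-no _ _ λ e → *-≉0 a≉0 x≉0 (trans (sym (decode-encode _)) e))
      (decode-encode _)

    ∏f≉0 : product f ≉ 0#
    ∏f≉0 = product-≉0 f f≉0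
      where
      f≉0 : ∀ i → f i ≉ 0#
      f≉0 i with decode i ≈? 0#
      ... | yes _   = 1≉0
      ... | no  x≉0 = x≉0

    ∏g≈1 : product g ≈ 1#
    ∏g≈1 = x∙y⁻¹≈ε⇒x≈y _ _ (*-cancelˡ-0 ∏f≉0 (trans (*-comm _ _)
      (trans ([y-z]x≈yx-zx (product f) (product g) 1#) (x≈y⇒x∙y⁻¹≈ε (begin
        product g * product f            ≈⟨ product-distrib-* g f ⟨
        product (λ i → g i * f i)        ≈⟨ product-cong f∘π≈gf ⟨
        product (f ∘ scale a)            ≈⟨ product-permute f π ⟨
        product f                        ≈⟨ *-identityˡ _ ⟨
        1# * product f                   ∎)))))

    ∏h≈a : product h ≈ a
    ∏h≈a = trans
      (product-single h (encode 0#) λ i i≢ → caseZero-no _ _ λ x≈0 →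
        i≢ (≡.trans (≡.sym (encode-decode i)) (encode-cong x≈0)))
      (caseZero-yes _ _ (decode-encode 0#))

    a≈gh : ∀ i → a ≈ g i * h i
    a≈gh i with decode i ≈? 0#
    ... | yes _ = sym (*-identityˡ a)
    ... | no  _ = sym (*-identityʳ a)

  fermat : ∀ a → a ^ q ≈ a
  fermat a with a ≈? 0#
  ... | no  a≉0 = fermat-unit a≉0
  ... | yes a≈0 = trans (^-congˡ q a≈0) (trans (0^n≈0 q (ℕ.<⇒≤ 2≤q)) (sym a≈0))

-- The Frobenius identity for polynomials.

module Frobenius {c ℓ : Level} {q : ℕ} (F : FiniteField c ℓ q) where
  private module F = FiniteField F
  open Polynomials F
  open PolynomialRing F
  open Degrees F
  open Roots F
  open Fermat F
  open Powers q 2≤q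
  open Exp (CommutativeRing.commutativeSemiring polynomialRing)
    using (_^_; ^-congˡ; ^-congʳ; ^-assocʳ; ^-distrib-*)
  open Exp F.commutativeSemiring using () renaming (_^_ to _^ᶠ_)
  open CommutativeRing polynomialRing using (setoid; *-identityʳ)
  open RingProperties (CommutativeRing.ring polynomialRing) using (x∙y⁻¹≈ε⇒x≈y; [y-z]x≈yx-zx; x≈y⇒x∙y⁻¹≈ε)

  const : F.Carrier → Poly
  const a = a ∷ []

  const-*-homo : ∀ a b → const (a F.* b) ≈ const a * const b
  const-*-homo a b = ∷-cong (F.sym (F.+-identityʳ _)) ≈-refl

  const-^ : ∀ a n → const a ^ n ≈ const (a ^ᶠ n)
  const-^ a zero    = ≈-refl
  const-^ a (suc n) = ≈-trans (*-congˡ (const a) (const-^ a n))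
    (≈-sym (const-*-homo a (a ^ᶠ n)))

  const-isSemiringHomomorphism : SemiringMorphisms.IsSemiringHomomorphism
    (Semiring.rawSemiring F.semiring)
    (Semiring.rawSemiring (CommutativeRing.semiring polynomialRing)) const
  const-isSemiringHomomorphism = record
    { isNearSemiringHomomorphism = record
      { +-isMonoidHomomorphism = record
        { isMagmaHomomorphism = record
          { isRelHomomorphism = record { cong = λ e → ∷-cong e ≈-refl }
          ; homo = λ _ _ → ≈-refl
          }
        ; ε-homo = ∷-≈0 F.refl ≈-refl
        }
      ; *-homo = const-*-homo
      }
    ; 1#-homo = ≈-refl
    }

  module Composition = Evaluation F polynomialRing const const-isSemiringHomomorphism

  leading-X : MonicOfDegree X 1
  leading-X = leading-∷ leading-1

  leading-X^ : ∀ n → MonicOfDegree (X ^ n) n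
  leading-X^ n = ≡.subst (MonicOfDegree (X ^ n)) (ℕ.*-identityʳ n) (monic-^ n leading-X)

  leading-1+X : MonicOfDegree (1# + X) 1
  leading-1+X = leading-cong (+-comm X 1#) (leading-+ leading-X (above leading-1))

  leading-[1+X]^ : ∀ n → MonicOfDegree ((1# + X) ^ n) n
  leading-[1+X]^ n =
    ≡.subst (MonicOfDegree ((1# + X) ^ n)) (ℕ.*-identityʳ n) (monic-^ n leading-1+X)

  -- The degree bound is imposed on the difference because both sides of the Frobenius identity have
  -- degree q; their leading terms cancel.
  agree⇒≈ : ∀ p r → Below (p + - r) q → (∀ x → eval p x F.≈ eval r x) → p ≈ r
  agree⇒≈ p r b agree = x∙y⁻¹≈ε⇒x≈y p r (vanishing⇒≈0 (p + - r) b λ x → begin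
    eval (p + - r) x                ≈⟨ eval-+ p (- r) x ⟩
    eval p x F.+ eval (- r) x       ≈⟨ F.+-congʳ (agree x) ⟩
    eval r x F.+ eval (- r) x       ≈⟨ eval-+ r (- r) x ⟨
    eval (r + - r) x                ≈⟨ eval-0 (r + - r) x (+-inverseʳ r) ⟩
    F.0#                            ∎)
    where open SetoidReasoning F.setoid

  [1+X]^q≈1+X^q : (1# + X) ^ q ≈ 1# + X ^ q
  [1+X]^q≈1+X^q = agree⇒≈ ((1# + X) ^ q) (1# + X ^ q)
    (leading-cancel (leading-[1+X]^ q) (leading-cong (+-comm (X ^ q) 1#)
      (leading-+ (leading-X^ q) (below-mono (ℕ.<⇒≤ 2≤q) (above leading-1))))) λ x → begin
      eval ((1# + X) ^ q) x           ≈⟨ eval-^ (1# + X) q x ⟩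
      eval (1# + X) x ^ᶠ q            ≈⟨ fermat _ ⟩
      eval (1# + X) x                 ≈⟨ eval-+ 1# X x ⟩
      eval 1# x F.+ eval X x          ≈⟨ F.+-congˡ (fermat _) ⟨
      eval 1# x F.+ eval X x ^ᶠ q     ≈⟨ F.+-congˡ (eval-^ X q x) ⟨
      eval 1# x F.+ eval (X ^ q) x    ≈⟨ eval-+ 1# (X ^ q) x ⟨
      eval (1# + X ^ q) x             ∎
    where open SetoidReasoning F.setoid

  open SetoidReasoning setoid

  -- Agreement on field elements has been upgraded to an identity in F[t], and such an identity
  -- survives the substitution of any polynomial z for X.
  [1+z]^q≈1+z^q : ∀ z → (1# + z) ^ q ≈ 1# + z ^ q
  [1+z]^q≈1+z^q z = begin
    (1# + z) ^ q                         ≈⟨ ^-congˡ q eval-1+X ⟨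
    C.eval (1# + X) z ^ q                ≈⟨ C.eval-^ (1# + X) q z ⟨
    C.eval ((1# + X) ^ q) z              ≈⟨ C.eval-cong _ _ z [1+X]^q≈1+X^q ⟩
    C.eval (1# + X ^ q) z                ≈⟨ C.eval-+ 1# (X ^ q) z ⟩
    C.eval 1# z + C.eval (X ^ q) z       ≈⟨ +-cong (C.eval-const F.1# z) (C.eval-^ X q z) ⟩
    1# + C.eval X z ^ q                  ≈⟨ +-cong (≈-refl {1#}) (^-congˡ q (C.eval-X z)) ⟩
    1# + z ^ q                           ∎
    where
    module C = Composition
    eval-1+X : C.eval (1# + X) z ≈ 1# + z
    eval-1+X = ≈-trans (C.eval-+ 1# X z) (+-cong (C.eval-const F.1# z) (C.eval-X z))

  const-fermat : ∀ a → const a ^ q ≈ const a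
  const-fermat a = ≈-trans (const-^ a q) (∷-cong (fermat a) ≈-refl)

  -- A non-zero a is pulled out, a + z = a (1 + z / a), and a^q = a restores it after the power is
  -- taken.
  [a+z]^q≈a+z^q : ∀ a z → (const a + z) ^ q ≈ const a + z ^ q
  [a+z]^q≈a+z^q a z with a F.≈? F.0#
  ... | yes a≈0 = begin
    (const a + z) ^ q    ≈⟨ ^-congˡ q (+-cong a≈[] (≈-refl {z})) ⟩
    z ^ q                ≈⟨ +-cong a≈[] (≈-refl {z ^ q}) ⟨
    const a + z ^ q      ∎
    where
    a≈[] : const a ≈ 0#
    a≈[] = ∷-≈0 a≈0 ≈-refl
  ... | no a≉0 = begin
    (const a + z) ^ q              ≈⟨ ^-congˡ q (expand 1# u u≈ (*-identityʳ _)) ⟨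
    (const a * (1# + u)) ^ q       ≈⟨ ^-distrib-* (const a) (1# + u) q ⟩
    const a ^ q * (1# + u) ^ q     ≈⟨ *-cong (const-fermat a) ([1+z]^q≈1+z^q u) ⟩
    const a * (1# + u ^ q)         ≈⟨ expand 1# (u ^ q) u^q≈ (*-identityʳ _) ⟩
    const a + z ^ q                ∎
    where
    a⁻¹ = proj₁ (F.inverse a a≉0)
    aa⁻¹≈1 = proj₂ (F.inverse a a≉0)
    u = const a⁻¹ * z
    expand : ∀ x y {x′ y′} → const a * y ≈ y′ → const a * x ≈ x′ → const a * (x + y) ≈ x′ + y′
    expand x y y≈ x≈ = ≈-trans (distribˡ (const a) x y) (+-cong x≈ y≈)
    u≈ : const a * u ≈ z
    u≈ = begin
      const a * (const a⁻¹ * z)   ≈⟨ *-assoc (const a) (const a⁻¹) z ⟨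
      const a * const a⁻¹ * z     ≈⟨ *-cong (const-*-homo a a⁻¹) (≈-refl {z}) ⟨
      const (a F.* a⁻¹) * z       ≈⟨ *-cong (∷-cong aa⁻¹≈1 (≈-refl {[]})) (≈-refl {z}) ⟩
      1# * z                      ≈⟨ *-identityˡ z ⟩
      z                           ∎
    u^q≈ : const a * u ^ q ≈ z ^ q
    u^q≈ = begin
      const a * u ^ q             ≈⟨ *-cong (const-fermat a) ≈-refl ⟨
      const a ^ q * u ^ q         ≈⟨ ^-distrib-* (const a) u q ⟨
      (const a * u) ^ q           ≈⟨ ^-congˡ q u≈ ⟩
      z ^ q                       ∎

  -- A constant as one summand is the shape that `∷≈const+X*` gives to a coefficient list, so this
  -- form matches induction on the list.
  frobenius : ∀ n a z → (const a + z) ^ (q ℕ.^ n) ≈ const a + z ^ (q ℕ.^ n)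
  frobenius zero    a z = ≈-trans (*-identityʳ _)
    (+-cong (≈-refl {const a}) (≈-sym (*-identityʳ z)))
  frobenius (suc n) a z = begin
    (const a + z) ^ (q ℕ.* q ℕ.^ n)     ≈⟨ ^-assocʳ (const a + z) q (q ℕ.^ n) ⟨
    ((const a + z) ^ q) ^ (q ℕ.^ n)     ≈⟨ ^-congˡ (q ℕ.^ n) ([a+z]^q≈a+z^q a z) ⟩
    (const a + z ^ q) ^ (q ℕ.^ n)       ≈⟨ frobenius n a (z ^ q) ⟩
    const a + (z ^ q) ^ (q ℕ.^ n)       ≈⟨ +-cong (≈-refl {const a}) (^-assocʳ z q (q ℕ.^ n)) ⟩
    const a + z ^ (q ℕ.* q ℕ.^ n)       ∎

  ∷≈const+X* : ∀ a p → a ∷ p ≈ const a + X * p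
  ∷≈const+X* a p = ≈-trans (∷-cong (F.sym (F.+-identityʳ a)) ≈-refl)
    (+-cong (≈-refl {const a}) (≈-sym (≈-trans (t·-* 1# p) (∷-cong F.refl (*-identityˡ p)))))

  -- Otherwise X^N - X, of degree below q, would vanish on the whole field and hence be zero.
  -- Applied to a residue field, this excludes that a proper iterate of Frobenius is the identity.
  no-small-exponent : ∀ N → 2 ℕ.≤ N → N ℕ.< q → ¬ (∀ x → x ^ᶠ N F.≈ x)
  no-small-exponent N 2≤N N<q x^N≈x = contradiction N≡1 (ℕ.>⇒≢ 2≤N)
    where
    X^N≈X : X ^ N ≈ X
    X^N≈X = agree⇒≈ (X ^ N) X
      (below-+ (below-mono N<q (above (leading-X^ N)))
        (below-neg (below-mono (ℕ.≤-trans 2≤N (ℕ.<⇒≤ N<q)) (above leading-X))))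
      λ x → F.trans (eval-^ X N x) (x^N≈x (eval X x))
    N≡1 = leading-unique F.1≉0 F.1≉0 (leading-X^ N) (leading-cong (≈-sym X^N≈X) leading-X)

  -- The polynomials `T n`: divisibility among them and square-freeness.

  T : ℕ → Poly
  T n = X ^ (q ℕ.^ n) + - X

  leading-T : ∀ {n} → 1 ℕ.≤ n → MonicOfDegree (T n) (q ℕ.^ n)
  leading-T {n} 1≤n = leading-+ (leading-X^ (q ℕ.^ n))
    (below-neg (below-mono (2≤q^ 1≤n) (above leading-X)))

  module Modulo (w : Poly) where
    open Quotient polynomialRing w public

    ^-congˡʷ : ∀ n {x y} → x ≈ʷ y → x ^ n ≈ʷ y ^ n
    ^-congˡʷ zero    x≈y = ≈⇒≈ʷ ≈-refl
    ^-congˡʷ (suc n) x≈y = *-congʷ x≈y (^-congˡʷ n x≈y)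

    -- Equivalent to `w ∣ T n`, but in a form that can be iterated by raising both sides to further
    -- powers.
    FixesX : ℕ → Set (c ⊔ ℓ)
    FixesX n = X ^ (q ℕ.^ n) ≈ʷ X

    ∣T⇒fixesX : ∀ {n} → w ∣ T n → FixesX n
    ∣T⇒fixesX = ∣-⇒≈ʷ

    fixesX⇒∣T : ∀ {n} → FixesX n → w ∣ T n
    fixesX⇒∣T = ≈ʷ⇒∣-

    X^q^[m+n] : ∀ m {n} → FixesX n → X ^ (q ℕ.^ (m ℕ.+ n)) ≈ʷ X ^ (q ℕ.^ m)
    X^q^[m+n] m {n} fixes = transʷ (≈⇒≈ʷ (begin
      X ^ (q ℕ.^ (m ℕ.+ n))           ≈⟨ ^-congʳ X (≡.trans (ℕ.^-distribˡ-+-* q m n)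
                                            (ℕ.*-comm (q ℕ.^ m) (q ℕ.^ n))) ⟩
      X ^ (q ℕ.^ n ℕ.* q ℕ.^ m)       ≈⟨ ^-assocʳ X (q ℕ.^ n) (q ℕ.^ m) ⟨
      (X ^ (q ℕ.^ n)) ^ (q ℕ.^ m)     ∎)) (^-congˡʷ (q ℕ.^ m) fixes)

    fixesX-multiple : ∀ k {n} → FixesX n → FixesX (k ℕ.* n)
    fixesX-multiple zero    fixes = ≈⇒≈ʷ (*-identityʳ X)
    fixesX-multiple (suc k) {n} fixes =
      transʷ (X^q^[m+n] n (fixesX-multiple k fixes)) fixes

    fixesX⇒fixes : ∀ n → FixesX n → ∀ p → p ^ (q ℕ.^ n) ≈ʷ p
    -- The zero polynomial needs q^n ≥ 1, as its power with exponent 0 would be 1.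
    fixesX⇒fixes n fixes [] with q ℕ.^ n | 1≤q^ n
    ... | suc _ | _ = ≈⇒≈ʷ ≈-refl
    fixesX⇒fixes n fixes (a ∷ p) = transʷ (≈⇒≈ʷ (begin
        (a ∷ p) ^ Q                   ≈⟨ ^-congˡ Q (∷≈const+X* a p) ⟩
        (const a + X * p) ^ Q         ≈⟨ frobenius n a (X * p) ⟩
        const a + (X * p) ^ Q         ≈⟨ +-cong (≈-refl {const a}) (^-distrib-* X p Q) ⟩
        const a + X ^ Q * p ^ Q       ∎))
      (transʷ (+-congʷ (≈⇒≈ʷ (≈-refl {const a})) (*-congʷ fixes (fixesX⇒fixes n fixes p)))
        (≈⇒≈ʷ (≈-sym (∷≈const+X* a p))))
      where Q = q ℕ.^ n

  -- Modulo `T m` the q^m-th power map fixes X, hence so does its k-fold iterate.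
  T-∣-T : ∀ m k → T m ∣ T (k ℕ.* m)
  T-∣-T m k = fixesX⇒∣T {k ℕ.* m} (fixesX-multiple k {m} (∣T⇒fixesX {m} (1# , *-identityˡ (T m))))
    where open Modulo (T m)

  ≉0-cancel-∣ : ∀ {h} → h ≉ 0# → h * h ∣ h → h ∣ 1#
  ≉0-cancel-∣ {h} h≉0 (k , khh≈h) = k , x∙y⁻¹≈ε⇒x≈y (k * h) 1# (p*r≈0⇒r≈0 h≉0 (begin
    h * (k * h + - 1#)        ≈⟨ *-comm h _ ⟩
    (k * h + - 1#) * h        ≈⟨ [y-z]x≈yx-zx h (k * h) 1# ⟩
    k * h * h + - (1# * h)    ≈⟨ x≈y⇒x∙y⁻¹≈ε (begin
      k * h * h                 ≈⟨ *-assoc k h h ⟩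
      k * (h * h)               ≈⟨ khh≈h ⟩
      h                         ≈⟨ *-identityˡ h ⟨
      1# * h                    ∎) ⟩
    0#                        ∎))

  -- Modulo h² every polynomial, in particular h, equals its qⁿ-th power, but h^(qⁿ) = 0.
  squareFree-T : ∀ {n} → 1 ℕ.≤ n → SquareFree (T n)
  squareFree-T {n} 1≤n h h²∣T = ≉0-cancel-∣ h≉0 (≈ʷ0⇒∣ (transʷ
    (symʷ (fixesX⇒fixes n (∣T⇒fixesX {n} h²∣T) h)) (h^≈0 (2≤q^ 1≤n))))
    where
    open Modulo (h * h)
    h^≈0 : ∀ {N} → 2 ℕ.≤ N → h ^ N ≈ʷ 0#
    h^≈0 {suc (suc N)} (s≤s (s≤s _)) = ∣⇒≈ʷ0 ((h ^ N) ,
      ≈-trans (*-comm (h ^ N) (h * h)) (*-assoc h h (h ^ N)))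
    h≉0 : h ≉ 0#
    h≉0 h≈0 = T≉0 h²∣T
      where
      T≉0 : h * h ∤ T n
      T≉0 (k , khh≈T) = leading-≉0 F.1≉0 (leading-T 1≤n) (begin
        T n           ≈⟨ khh≈T ⟨
        k * (h * h)   ≈⟨ *-congˡ k (*-cong h≈0 (≈-refl {h})) ⟩
        k * 0#        ≈⟨ *-zeroʳ k ⟩
        0#            ∎)

-- Division with remainder by P.

module Division {c ℓ : Level} {q : ℕ} (F : FiniteField c ℓ q)
  (P : Polynomials.Poly F) {e : ℕ} {a : FiniteField.Carrier F}
  (a≉0 : ¬ (FiniteField._≈_ F a (FiniteField.0# F)))
  (leading-P : Degrees.Leading F P e a) where
  private module F = FiniteField F
  open Polynomials F
  open PolynomialRing F
  open Degrees F
  open Roots F using (X)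
  open Frobenius F using (const; ∷≈const+X*)
  open Quotient polynomialRing P public

  -- Division in Horner order: the tail is already reduced to degree below e, so `x ∷ r` has degree
  -- at most e and subtracting one scalar multiple of P removes the coefficient at e.
  remainder : ∀ f → ∃ λ r → Below r e × f ≈ʷ r
  remainder [] = [] , 0-below ≈-refl , ≈⇒≈ʷ ≈-refl
  remainder (x ∷ f) with r , b , f≈r ← remainder f =
    u + - (b/a · P) , leading-cancel (leading F.refl (below-∷ b)) leading-b/a·P , x∷f≈
    where
    u = x ∷ r
    a⁻¹ = proj₁ (F.inverse a a≉0)
    b/a = coeff u e F.* a⁻¹
    leading-b/a·P : Leading (b/a · P) e (coeff u e)
    leading-b/a·P with leading eq v ← leading-· b/a leading-P =
      leading (F.trans eq (F.trans (F.*-assoc _ _ _) (F.trans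
        (F.*-congˡ (F.trans (F.*-comm a⁻¹ a) (proj₂ (F.inverse a a≉0)))) (F.*-identityʳ _)))) v
    b/a·P≈0 : b/a · P ≈ʷ 0#
    b/a·P≈0 = ∣⇒≈ʷ0 (const b/a , const-* b/a P)
    x∷f≈ : x ∷ f ≈ʷ u + - (b/a · P)
    x∷f≈ = transʷ (≈⇒≈ʷ (∷≈const+X* x f)) (transʷ
      (+-congʷ (≈⇒≈ʷ (≈-refl {const x})) (*-congʷ (≈⇒≈ʷ (≈-refl {X})) f≈r)) (transʷ
      (≈⇒≈ʷ (≈-trans (≈-sym (∷≈const+X* x r)) (≈-sym (+-identityʳ u))))
      (+-congʷ (≈⇒≈ʷ (≈-refl {u})) (-‿congʷ (symʷ b/a·P≈0)))))

  below⇒≈0 : ∀ {r} → Below r e → r ≈ʷ 0# → r ≈ 0#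
  below⇒≈0 {r} b r≈ʷ0 with zeroOrLeading r
  ... | inj₁ r≈0 = r≈0
  ... | inj₂ (n , _ , b≉0 , lr) = contradiction
    (∣-degree a≉0 b≉0 leading-P lr (≈ʷ0⇒∣ r≈ʷ0)) (ℕ.<⇒≱ (leading-below b≉0 lr b))

  remainder-unique : ∀ {r s} → Below r e → Below s e → r ≈ʷ s → r ≈ s
  remainder-unique {r} {s} br bs r≈s = x∙y⁻¹≈ε⇒x≈y r s (below⇒≈0 (below-+ br (below-neg bs))
    (transʷ (+-congʷ r≈s (≈⇒≈ʷ (≈-refl { - s}))) (≈⇒≈ʷ (+-inverseʳ s))))
    where open RingProperties (CommutativeRing.ring polynomialRing) using (x∙y⁻¹≈ε⇒x≈y)

-- The residue field F[t]/(P) of an irreducible P.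

module ResidueField {c ℓ : Level} {q : ℕ} (F : FiniteField c ℓ q)
  (P : Polynomials.Poly F) {e : ℕ} {a : FiniteField.Carrier F}
  (a≉0 : ¬ (FiniteField._≈_ F a (FiniteField.0# F)))
  (leading-P : Degrees.Leading F P e a) (irreducible : Polynomials.Irreducible F P) where
  private module F = FiniteField F
  open Polynomials F hiding (Irreducible)
  open PolynomialRing F
  open Degrees F
  open Roots F
  open Division F P a≉0 leading-P
  open RawSemiring.Irreducible irreducible
  private module K = CommutativeRing quotientRing

  -- Euclid's algorithm: P = s r + r′ gives r′ ≡ − s r, so an inverse of r′ yields one of r.
  inverse-below : ∀ n r → Below r n → n ℕ.≤ e → r ≉ 0# → ∃ λ y → r * y ≈ʷ 1#
  inverse-below zero    r b n≤e r≉0 = contradiction (below-0 b) r≉0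
  inverse-below (suc n) r b n≤e r≉0 with zeroOrLeading r
  ... | inj₁ r≈0 = contradiction r≈0 r≉0
  ... | inj₂ (k , b₀ , b₀≉0 , lr) with Division.remainder F r b₀≉0 lr P
  ... | r′ , br′ , Quotient.by s P≈ with zeroOrLeading r′
  ... | inj₁ r′≈0 = unit-r (split-∣1 P≈sr)
    where
    P≈sr : P ≈ s * r
    P≈sr = ≈-trans P≈ (+-cong r′≈0 (≈-refl {s * r}))
    unit-r : s ∣ 1# ⊎ r ∣ 1# → ∃ λ y → r * y ≈ʷ 1#
    -- If the cofactor s is a unit, P divides r, whose degree is below e.
    unit-r (inj₁ (u , us≈1)) = contradiction (∣-degree a≉0 b₀≉0 leading-P lr P∣r)
      (ℕ.<⇒≱ (ℕ.<-≤-trans (leading-below b₀≉0 lr b) n≤e))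
      where
      P∣r : P ∣ r
      P∣r = u , ≈-trans (*-congˡ u P≈sr) (≈-trans (≈-sym (*-assoc u s r))
        (≈-trans (*-cong us≈1 (≈-refl {r})) (*-identityˡ r)))
    unit-r (inj₂ (u , ur≈1)) = u , ≈⇒≈ʷ (≈-trans (*-comm r u) ur≈1)
  ... | inj₂ (_ , _ , b₁≉0 , lr′)
    with y , r′y≈1 ← inverse-below n r′
           (below-mono (ℕ.s≤s⁻¹ (leading-below b₀≉0 lr b)) br′)
           (ℕ.≤-trans (ℕ.n≤1+n n) n≤e) (leading-≉0 b₁≉0 lr′) =
    - s * y , (begin
      r * (- s * y)    ≈⟨ K.*-assoc r (- s) y ⟨
      r * - s * y      ≈⟨ K.*-congʳ (K.*-comm r (- s)) ⟩
      - s * r * y      ≈⟨ K.*-congʳ r′≈-sr ⟨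
      r′ * y           ≈⟨ r′y≈1 ⟩
      1#               ∎)
    where
    open SetoidReasoning K.setoid
    open RingProperties K.ring using (+-inverseˡ-unique; -‿distribˡ-*)
    r′≈-sr : r′ ≈ʷ - s * r
    r′≈-sr = transʷ (+-inverseˡ-unique r′ (s * r) (transʷ (≈⇒≈ʷ (≈-sym P≈)) w≈ʷ0))
      (-‿distribˡ-* s r)

  inverseʷ : ∀ x → ¬ (x ≈ʷ 0#) → ∃ λ y → x * y ≈ʷ 1#
  inverseʷ x x≉0 = lift (inverse-below e (proj₁ (remainder x)) (proj₁ (proj₂ (remainder x)))
    ℕ.≤-refl λ r≈0 → x≉0 (transʷ x≈r (≈⇒≈ʷ r≈0)))
    where
    x≈r = proj₂ (proj₂ (remainder x))
    lift : (∃ λ y → proj₁ (remainder x) * y ≈ʷ 1#) → ∃ λ y → x * y ≈ʷ 1#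
    lift (y , ry≈1) = y , transʷ (*-congʷ x≈r (≈⇒≈ʷ (≈-refl {y}))) ry≈1

  private
    funToFin-cong : ∀ {m n} {f g : Fin m → Fin n} → (∀ i → f i ≡ g i) →
                    Fin.funToFin f ≡ Fin.funToFin g
    funToFin-cong {zero}  f≗g = ≡.refl
    funToFin-cong {suc m} f≗g = ≡.cong₂ Fin.combine (f≗g zero) (funToFin-cong (f≗g ∘ suc))

    coeff-tabulate : ∀ {n} (f : Fin n → F.Carrier) i → coeff (tabulate f) (Fin.toℕ i) ≡ f i
    coeff-tabulate f zero    = ≡.refl
    coeff-tabulate f (suc i) = coeff-tabulate (f ∘ suc) i

    below-tabulate : ∀ {n} (f : Fin n → F.Carrier) → Below (tabulate f) n
    below-tabulate {zero}  f = 0-below ≈-refl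
    below-tabulate {suc n} f = below-∷ (below-tabulate (f ∘ suc))

  digits : Poly → Fin e → Fin q
  digits f i = encode (coeff (proj₁ (remainder f)) (Fin.toℕ i))

  -- The e coefficients of the remainder, as digits in base q, number the residue classes; hence the
  -- cardinality q^e.
  index : Poly → Fin (q ℕ.^ e)
  index f = Fin.funToFin (digits f)

  remainder-cong : ∀ {f g} → f ≈ʷ g → proj₁ (remainder f) ≈ proj₁ (remainder g)
  remainder-cong {f} {g} f≈g with r , br , f≈r ← remainder f | s , bs , g≈s ← remainder g =
    remainder-unique br bs (transʷ (symʷ f≈r) (transʷ f≈g g≈s))

  remainder-injective : ∀ {f g} → proj₁ (remainder f) ≈ proj₁ (remainder g) → f ≈ʷ g
  remainder-injective {f} {g} r≈s with r , br , f≈r ← remainder f | s , bs , g≈s ← remainder g =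
    transʷ f≈r (transʷ (≈⇒≈ʷ r≈s) (symʷ g≈s))

  index-cong : ∀ {f g} → f ≈ʷ g → index f ≡ index g
  index-cong {f} {g} f≈g = funToFin-cong {e} λ i →
    encode-cong (coeff-≈ (remainder-cong {f} {g} f≈g) (Fin.toℕ i))

  index-injective : ∀ {f g} → index f ≡ index g → f ≈ʷ g
  index-injective {f} {g} eq = remainder-injective {f} {g} (mk≈ coeffs)
    where
    coeffs : ∀ n → coeff (proj₁ (remainder f)) n F.≈ coeff (proj₁ (remainder g)) n
    coeffs n with n ℕ.<? e
    ... | no  n≮e = F.trans (vanish (proj₁ (proj₂ (remainder f))) n (ℕ.≮⇒≥ n≮e))
      (F.sym (vanish (proj₁ (proj₂ (remainder g))) n (ℕ.≮⇒≥ n≮e)))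
    ... | yes n<e = ≡.subst (λ m → coeff (proj₁ (remainder f)) m F.≈ coeff (proj₁ (remainder g)) m)
      (Fin.toℕ-fromℕ< n<e) (Bijection.injective F.enumeration (≡.trans
        (≡.sym (Fin.finToFun-funToFin (digits f) i)) (≡.trans
        (≡.cong (λ k → Fin.finToFun k i) eq) (Fin.finToFun-funToFin (digits g) i))))
      where i = Fin.fromℕ< n<e

  index-surjective : ∀ k → ∃ λ f → index f ≡ k
  index-surjective k = f , ≡.trans (funToFin-cong {e} digit) (Fin.funToFin-finToFin {e} {q} k)
    where
    f = tabulate (decode ∘ Fin.finToFun k)
    -- The polynomial with the prescribed digits has degree below e and is its own remainder.
    rem≈f : proj₁ (remainder f) ≈ f
    rem≈f with r , b , f≈r ← remainder f =
      remainder-unique b (below-tabulate (decode ∘ Fin.finToFun k)) (symʷ f≈r)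
    digit : ∀ i → digits f i ≡ Fin.finToFun k i
    digit i = ≡.trans (encode-cong (F.trans (coeff-≈ rem≈f (Fin.toℕ i))
      (F.reflexive (coeff-tabulate (decode ∘ Fin.finToFun k) i)))) (encode-decode _)

  residueField : FiniteField c (c ⊔ ℓ) (q ℕ.^ e)
  residueField = record
    { commutativeRing = quotientRing
    ; 1≉0             = λ 1≈0 → p∤1 (≈ʷ0⇒∣ 1≈0)
    ; inverse         = inverseʷ
    ; enumeration     = record
      { to        = index
      ; cong      = λ {f} {g} → index-cong {f} {g}
      ; bijective = (λ {f} {g} → index-injective {f} {g}) ,
                    λ k → proj₁ (index-surjective k) , λ {z} z≈f →
                      ≡.trans (index-cong {z} z≈f) (proj₂ (index-surjective k))
      }
    }

-- Degrees of the irreducible factors of `T n`.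

module FactorDegrees {c ℓ : Level} {q : ℕ} (F : FiniteField c ℓ q) where
  private module F = FiniteField F
  open Polynomials F
  open PolynomialRing F
  open Degrees F
  open Roots F using (X)
  open Frobenius F
  open Fermat F using (2≤q)
  open Powers q 2≤q
  open Exp (CommutativeRing.commutativeSemiring polynomialRing) using (_^_)

  -- Modulo P, X is fixed by the power maps for n and, by Fermat in the residue field, for `suc e`;
  -- hence also for the remainder r of n. A non-zero r would make every residue class satisfy
  -- x^(q^r) = x, with an exponent smaller than the cardinality q^(suc e).
  degree-∣ : ∀ {P e a n} → a F.≉ F.0# → Leading P (suc e) a → Irreducible P → P ∣ T n →
             suc e ℕ.∣ n
  degree-∣ {P} {e} {a} {n} a≉0 leading-P irreducible P∣T with n % suc e ℕ.≟ 0
  ... | yes r≡0 = ℕ.m%n≡0⇒n∣m n (suc e) r≡0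
  ... | no  r≢0 = contradiction K-fixed
    (Frobenius.no-small-exponent K (q ℕ.^ r) (2≤q^ (ℕ.n≢0⇒n>0 r≢0))
      (ℕ.^-monoʳ-< q 2≤q (m%n<n n (suc e))))
    where
    open Modulo P
    K = ResidueField.residueField F P a≉0 leading-P irreducible
    r = n % suc e
    open Exp (FiniteField.commutativeSemiring K) using () renaming (_^_ to _^ᴷ_)

    -- The same power, but the two terms differ in the equality relation they are indexed by.
    ^ᴷ≈^ : ∀ x m → x ^ᴷ m ≈ʷ x ^ m
    ^ᴷ≈^ x zero    = ≈⇒≈ʷ ≈-refl
    ^ᴷ≈^ x (suc m) = *-congʷ (≈⇒≈ʷ (≈-refl {x})) (^ᴷ≈^ x m)

    fixes-suc-e : FixesX (suc e)
    fixes-suc-e = transʷ (symʷ (^ᴷ≈^ X (q ℕ.^ suc e))) (Fermat.fermat K X)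

    fixes-r : FixesX r
    fixes-r = transʷ (symʷ (X^q^[m+n] r (fixesX-multiple (n / suc e) {suc e} fixes-suc-e)))
      (≡.subst FixesX (m≡m%n+[m/n]*n n (suc e)) (∣T⇒fixesX {n} P∣T))

    K-fixed : ∀ x → x ^ᴷ (q ℕ.^ r) ≈ʷ x
    K-fixed x = transʷ (^ᴷ≈^ x (q ℕ.^ r)) (fixesX⇒fixes r fixes-r x)

-- The quotients g and the infinite family.

module Construction {c ℓ : Level} {q : ℕ} (F : FiniteField c ℓ q) where
  private module F = FiniteField F
  open Polynomials F
  open PolynomialRing F
  open Degrees F
  open Frobenius F
  open Fermat F using (2≤q)
  open Powers q 2≤q
  open FactorDegrees F

  -- `N ℕ.+ m ≡ n` expresses the degree n - m without subtraction, the form in which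
  -- `degree-divisible` and `degree-increasing` accept it.
  monic-quotient : ∀ {k w f m n} → MonicOfDegree w m → MonicOfDegree f n → k * w ≈ f →
                   ∃ λ N → N ℕ.+ m ≡ n × MonicOfDegree k N
  monic-quotient {k} {w} {f} lw lf kw≈f with zeroOrLeading k
  ... | inj₁ k≈0 = contradiction (≈-trans (≈-sym kw≈f) (*-cong k≈0 (≈-refl {w})))
    (leading-≉0 F.1≉0 lf)
  ... | inj₂ (N , a , a≉0 , lk)
    with lkw ← leading-cong kw≈f (leading-* lk lw)
    with ≡.refl ← leading-unique (*-≉0 a≉0 F.1≉0) F.1≉0 lkw lf =
    N , ≡.refl , leading (F.trans (coefficient lk) (F.trans (F.sym (F.*-identityʳ a))
      (F.trans (F.sym (coefficient lkw)) (coefficient lf)))) (above lk)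

  monic-proper-quotient∤1 : ∀ {k w f m n} → MonicOfDegree w m → MonicOfDegree f n →
                            m ℕ.< n → k * w ≈ f → k ∤ 1#
  monic-proper-quotient∤1 lw lf m<n kw≈f with monic-quotient lw lf kw≈f
  ... | zero  , ≡.refl , lk = contradiction m<n (ℕ.<-irrefl ≡.refl)
  ... | suc N , _      , lk = monic∤1 (s≤s z≤n) lk

  ∣-trans : ∀ {x y z} → x ∣ y → y ∣ z → x ∣ z
  ∣-trans {x} (k , kx≈y) (l , ly≈z) = l * k ,
    ≈-trans (*-assoc l k x) (≈-trans (*-congˡ l kx≈y) ly≈z)

  T-mono-∣ : ∀ {m n} → m ℕ.∣ n → T m ∣ T n
  T-mono-∣ {m} (ℕ.divides k ≡.refl) = T-∣-T m k

  -- Square-freeness and the degrees of irreducible factors are inherited from `T` through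
  -- `divides-T`.
  record Member (b v : ℕ) : Set (c ⊔ ℓ) where
    field
      poly         : Poly
      degree       : ℕ
      monic        : MonicOfDegree poly degree
      degree≡      : degree ℕ.+ q ℕ.^ (q ℕ.^ b) ≡ q ℕ.^ (q ℕ.^ (b ℕ.+ v))
      isReducible  : Reducible poly
      divides-T    : poly ∣ T (q ℕ.^ (b ℕ.+ v))

  -- The reason for the modulus d!: it serves every i from 1 to d at once.
  i≤d⇒i∣d! : ∀ {i d} → 1 ℕ.≤ i → i ℕ.≤ d → i ℕ.∣ d ℕ.!
  i≤d⇒i∣d! {suc i} _ i≤d = ℕ.∣-trans (ℕ.m∣m*n (i ℕ.!)) (ℕ.m≤n⇒m!∣n! i≤d)

  -- T(q^b) ∣ T(q^(b+1)) ∣ T(q^(b+v)), and the two successive quotients are the proper factors.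
  member : ∀ b v → 2 ℕ.≤ v → Member b v
  member b (suc (suc v)) (s≤s (s≤s _)) = build (T-mono-∣ (ℕ.n∣m*n q)) (T-mono-∣ c∣n)
    where
    m c′ n : ℕ
    m  = q ℕ.^ b
    c′ = q ℕ.^ suc b
    n  = q ℕ.^ (b ℕ.+ suc (suc v))
    c′<n : c′ ℕ.< n
    c′<n = ℕ.^-monoʳ-< q 2≤q (≡.subst (suc b ℕ.<_) (≡.sym (ℕ.+-suc b (suc v)))
      (s≤s (ℕ.m<m+n b (s≤s z≤n))))
    m<c′ : m ℕ.< c′
    m<c′ = ℕ.^-monoʳ-< q 2≤q (ℕ.n<1+n b)
    c∣n : c′ ℕ.∣ n
    c∣n = ≡.subst (c′ ℕ.∣_) (≡.trans (≡.sym (ℕ.^-distribˡ-+-* q (suc b) (suc v)))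
      (≡.cong (q ℕ.^_) (≡.sym (ℕ.+-suc b (suc v))))) (ℕ.m∣m*n (q ℕ.^ suc v))
    build : T m ∣ T c′ → T c′ ∣ T n → Member b (suc (suc v))
    build (g₂ , g₂Tm≈Tc) (g₁ , g₁Tc≈Tn) with gTm≈Tn ←
      ≈-trans (*-assoc g₁ g₂ (T m)) (≈-trans (*-congˡ g₁ g₂Tm≈Tc) g₁Tc≈Tn)
      with N , N≡ , lg ← monic-quotient (leading-T (1≤q^ b)) (leading-T (1≤q^ (b ℕ.+ suc (suc v)))) gTm≈Tn
      = record
      { poly        = g₁ * g₂
      ; degree      = N
      ; monic       = lg
      ; degree≡     = N≡
      ; isReducible = g₁ , g₂ ,
          monic-proper-quotient∤1 (leading-T (1≤q^ (suc b))) (leading-T (1≤q^ (b ℕ.+ suc (suc v))))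
            (ℕ.^-monoʳ-< q 2≤q c′<n) g₁Tc≈Tn ,
          monic-proper-quotient∤1 (leading-T (1≤q^ b)) (leading-T (1≤q^ (suc b)))
            (ℕ.^-monoʳ-< q 2≤q m<c′) g₂Tm≈Tc ,
          ≈-refl
      ; divides-T   = T m , ≈-trans (*-comm (T m) (g₁ * g₂)) gTm≈Tn
      }

  infinitelyManyRigid : ∀ d → InfinitelyMany (λ g → Monic g × RigidCarmichael d g)
  infinitelyManyRigid d = family (degree-divisible (d ℕ.!) {{d ℕ.!≢0}})
   where
   family : (∃₂ λ b₀ v → 2 ℕ.≤ v × (∀ b → b₀ ℕ.≤ b → ∀ N →
              N ℕ.+ q ℕ.^ (q ℕ.^ b) ≡ q ℕ.^ (q ℕ.^ (b ℕ.+ v)) → d ℕ.! ℕ.* q ℕ.^ (b ℕ.+ v) ℕ.∣ N)) →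
            InfinitelyMany (λ g → Monic g × RigidCarmichael d g)
   family (b₀ , v , 2≤v , divisible) =
    g , g-injective , λ k → g-monic k , record
      { reducible  = M.isReducible k
      ; squareFree = λ h h²∣g →
          squareFree-T (1≤q^ (b k ℕ.+ v)) h (∣-trans h²∣g (M.divides-T k))
      ; divides    = divides k
      }
    where
    b : ℕ → ℕ
    b k = b₀ ℕ.+ k
    module M k = Member (member (b k) v 2≤v)
    g : ℕ → Poly
    g = M.poly
    g-deg : ∀ k → deg (g k) ≡ M.degree k
    g-deg k = deg-leading F.1≉0 (M.monic k)
    g-monic : ∀ k → Monic (g k)
    g-monic k = F.trans (F.reflexive (≡.cong (coeff (g k)) (g-deg k))) (coefficient (M.monic k))
    degree-< : ∀ {k l} → k ℕ.< l → M.degree k ℕ.< M.degree l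
    degree-< {k} {l} k<l = degree-increasing {m = q ℕ.^ b k} (M.degree≡ k) (M.degree≡ l)
      (ℕ.^-monoʳ-< q 2≤q (ℕ.+-monoˡ-< v (ℕ.+-monoʳ-< b₀ k<l)))
      (ℕ.^-monoʳ-< q 2≤q (ℕ.m<m+n (b l) (ℕ.≤-trans (s≤s z≤n) 2≤v)))
    sameDegree : ∀ k l → g k ≈ g l → M.degree k ≡ M.degree l
    sameDegree k l gk≈gl =
      leading-unique F.1≉0 F.1≉0 (leading-cong gk≈gl (M.monic k)) (M.monic l)
    g-injective : Injective _≡_ _≈_ g
    g-injective {k} {l} gk≈gl with ℕ.<-cmp k l
    ... | tri≈ _ k≡l _ = k≡l
    ... | tri< k<l _ _ = contradiction (sameDegree k l gk≈gl) (ℕ.<⇒≢ (degree-< k<l))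
    ... | tri> _ _ l<k = contradiction (sameDegree k l gk≈gl) (ℕ.>⇒≢ (degree-< l<k))
    divides : ∀ k P → Irreducible P → P ∣ g k → ∀ i → 1 ℕ.≤ i → i ℕ.≤ d →
              i ℕ.* deg P ℕ.∣ d ℕ.* deg (g k)
    divides k P irreducible P∣g i 1≤i i≤d with zeroOrLeading P
    ... | inj₁ P≈0 = contradiction P∣g P∤g
      where
      P∤g : P ∤ g k
      P∤g (s , sP≈g) = leading-≉0 F.1≉0 (M.monic k)
        (≈-trans (≈-sym sP≈g) (≈-trans (*-congˡ s P≈0) (*-zeroʳ s)))
    ... | inj₂ (zero , _ , a≉0 , lP) = contradiction (const∣1 a≉0 lP) (Irreducible.p∤1 irreducible)
    -- i divides d! and deg P divides q^(b k + v), so their product divides the number that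
    -- `divisible` places in the degree of `g k`.
    ... | inj₂ (suc e , _ , a≉0 , lP) = ℕ.∣n⇒∣m*n d (ℕ.∣-trans
      (ℕ.*-pres-∣ (i≤d⇒i∣d! 1≤i i≤d) degP∣n)
      (≡.subst (d ℕ.! ℕ.* q ℕ.^ (b k ℕ.+ v) ℕ.∣_) (≡.sym (g-deg k))
        (divisible (b k) (ℕ.m≤m+n b₀ k) (M.degree k) (M.degree≡ k))))
      where
      degP∣n : deg P ℕ.∣ q ℕ.^ (b k ℕ.+ v)
      degP∣n = ≡.subst (ℕ._∣ q ℕ.^ (b k ℕ.+ v)) (≡.sym (deg-leading a≉0 lP))
        (degree-∣ a≉0 lP irreducible (∣-trans P∣g (M.divides-T k)))

theorem4p8 : {c ℓ : Level} {q : ℕ} (F : FiniteField c ℓ q) →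
    let open Polynomials F in
    (d : ℕ) → .{{_ : NonZero d}} →
    InfinitelyMany (λ g → Monic g × RigidCarmichael d g)
theorem4p8 F d = Construction.infinitelyManyRigid F d
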